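{- Let $p$ be a prime and $r\ge1$ an integer with $p^r\ge 3$. Let $C=\{C_0,\dots,C_{p^r}\}$ be the $(p^{2r},p^r-1,p^r-2)$ disjoint difference family in $(\mathbb{F}_{p^{2r}},+)$ given by the cosets in $\mathbb{F}_{p^{2r}}^*$ of the subgroup of order $p^r-1$ (index $p^r+1$). Let $E=\{(1+p\alpha)\mathcal{T}^* : \alpha\in\mathcal{T}\}\cup\{p\mathcal{T}^*\}$ be the disjoint difference family with the same parameters in the additive group of the Galois ring $\mathrm{GR}(p^2,r)$, where $\mathcal{T}$ is the Teichmüller set of $\mathrm{GR}(p^2,r)$ and $\mathcal{T}^*=\mathcal{T}\setminus\{0\}$. Then the $2$-$(p^{2r},p^r-1,p^r-2)$ designs $dev(C)$ and $dev(E)$ are isomorphic if $p=3$ and $r=1$, and they are nonisomorphic in every other case.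
   Context: Difference families and designs. For a subset $A$ of an abelian group $G$, $\Delta A$ is the multiset $\{a-a' : a,a'\in A, a\neq a'\}$. A collection of mutually disjoint $k$-subsets $D_1,\dots,D_b$ of an abelian group $G$ of order $v$ is a $(v,k,\lambda)$ disjoint difference family if each nonzero element of $G$ occurs exactly $\lambda$ times in the multiset union $\bigcup_i \Delta D_i$. The development $dev(D)$ of a family $D=\{D_1,\dots,D_b\}$ is the collection of all translates $D_i+g$ ($1\le i\le b$, $g\in G$); if $D$ is a $(v,k,\lambda)$ difference family then $dev(D)$, with point set $G$, is a $2$-$(v,k,\lambda)$ design, i.e. a collection of $k$-subsets (blocks) of a $v$-set of points such that each $2$-subset of points lies in exactly $\lambda$ blocks. Two designs are isomorphic if there is a bijection between their point sets that maps the collection of blocks of one onto the collection of blocks of the other. Finite field construction. Let $q$ be a prime power, $\alpha$ a generator of $\mathbb{F}_q^*$, and $ef=q-1$ with $e,f\ge2$. Put $C_i=\{\alpha^t : t\equiv i \pmod e\}$ for $i=0,\dots,e-1$. Then $C=\{C_0,\dots,C_{e-1}\}$ is a $(q,f,f-1)$ disjoint difference family in $(\mathbb{F}_q,+)$. Here $q=p^{2r}$, $e=p^r+1$, $f=p^r-1$. Galois rings. $\mathrm{GR}(p^2,r)=\mathbb{Z}_{p^2}[x]/\langle f(x)\rangle$, where $\mathbb{Z}_{p^2}$ is the ring of integers modulo $p^2$ and $f$ is a monic basic irreducible polynomial of degree $r$ (monic and irreducible modulo $p$); it is unique up to isomorphism. It contains an element $\xi$ of multiplicative order $p^r-1$,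 and $\mathcal{T}=\{0,1,\xi,\dots,\xi^{p^r-2}\}$ is its Teichmüller set (a system of representatives modulo the maximal ideal $p\,\mathrm{GR}(p^2,r)$). It is known that $E$ is a $(p^{2r},p^r-1,p^r-2)$ disjoint difference family in $(\mathrm{GR}(p^2,r),+)$. -}

module Defs where

open import Algebra.Bundles using (AbelianGroup; CommutativeRing; Semiring)
import Algebra.Definitions.RawSemiring as RawSemiringDefs
import Algebra.Properties.Ring as RingProperties
import Algebra.Properties.CommutativeSemigroup as CommutativeSemigroupProperties
open import Data.Fin.Base using (Fin; zero; suc; toℕ)
open import Data.Integer.Base using (ℤ; +_)
import Data.Integer.Properties as ℤ
open import Data.List.Base using (List; []; _∷_; map)
open import Data.Maybe.Base using (Maybe; just; nothing)
open import Data.Nat.Base as ℕ using (ℕ; zero; suc; _∸_; _%_)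
open import Data.Product.Base using (∃; _×_; _,_)
open import Data.Product.Relation.Binary.Pointwise.NonDependent using (_×ₛ_)
open import Function.Bundles using (Inverse; _⇔_)
open import Level using (Level; _⊔_; 0ℓ) renaming (suc to ℓsuc)
open import Relation.Binary.Bundles using (Setoid)
open import Relation.Binary.PropositionalEquality as ≡ using (_≡_)
open import Relation.Nullary.Negation.Core using (¬_)
open import Relation.Unary using (Pred)

private
  module RingDefs {c ℓ} (R : CommutativeRing c ℓ) =
    RawSemiringDefs (Semiring.rawSemiring (CommutativeRing.semiring R))

  variable
    a c ℓ p p′ b b′ i q q′ d d′ j : Level

------------------------------------------------------------------------
-- Quotient of a commutative ring by a principal ideal

module Quotient (R : CommutativeRing c ℓ) (m : CommutativeRing.Carrier R) where

  open CommutativeRing R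
  open RingDefs R using (_∣_)
  open import Algebra.Definitions.RawMagma (CommutativeRing.*-rawMagma R) using (_,_)
  open RingProperties ring using (-‿distribˡ-*; -‿distribʳ-*; -‿+-comm; -‿involutive)
  open CommutativeSemigroupProperties
    (CommutativeRing.+-commutativeSemigroup R) using (interchange)
  open import Relation.Binary.Reasoning.Setoid setoid

  infix 4 _≈/_

  record _≈/_ (x y : Carrier) : Set (c ⊔ ℓ) where
    constructor mk≈/
    field
      divides-difference : m ∣ (x - y)

  private
    ≈⇒≈/ : ∀ {x y} → x ≈ y → x ≈/ y
    ≈⇒≈/ {x} {y} x≈y = mk≈/ (0# , (begin
      0# * m  ≈⟨ zeroˡ m ⟩
      0#      ≈⟨ -‿inverseʳ y ⟨
      y - y   ≈⟨ +-congʳ x≈y ⟨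
      x - y   ∎))

    sym/ : ∀ {x y} → x ≈/ y → y ≈/ x
    sym/ {x} {y} (mk≈/ (k , km≈x-y)) = mk≈/ (- k , (begin
      - k * m        ≈⟨ -‿distribˡ-* k m ⟨
      - (k * m)      ≈⟨ -‿cong km≈x-y ⟩
      - (x - y)      ≈⟨ -‿+-comm x (- y) ⟨
      - x + - - y    ≈⟨ +-congˡ (-‿involutive y) ⟩
      - x + y        ≈⟨ +-comm (- x) y ⟩
      y - x          ∎))

    trans/ : ∀ {x y z} → x ≈/ y → y ≈/ z → x ≈/ z
    trans/ {x} {y} {z} (mk≈/ (k , e)) (mk≈/ (l , e′)) = mk≈/ (k + l , (begin
      (k + l) * m            ≈⟨ distribʳ m k l ⟩
      k * m + l * m          ≈⟨ +-cong e e′ ⟩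
      (x - y) + (y - z)      ≈⟨ +-assoc x (- y) (y - z) ⟩
      x + (- y + (y - z))    ≈⟨ +-congˡ (+-assoc (- y) y (- z)) ⟨
      x + ((- y + y) - z)    ≈⟨ +-congˡ (+-congʳ (-‿inverseˡ y)) ⟩
      x + (0# - z)           ≈⟨ +-congˡ (+-identityˡ (- z)) ⟩
      x - z                  ∎))

    +-cong/ : ∀ {x y u v} → x ≈/ y → u ≈/ v → x + u ≈/ y + v
    +-cong/ {x} {y} {u} {v} (mk≈/ (k , e)) (mk≈/ (l , e′)) = mk≈/ (k + l , (begin
      (k + l) * m            ≈⟨ distribʳ m k l ⟩
      k * m + l * m          ≈⟨ +-cong e e′ ⟩
      (x - y) + (u - v)      ≈⟨ interchange x (- y) u (- v) ⟩
      (x + u) + (- y - v)    ≈⟨ +-congˡ (-‿+-comm y v) ⟩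
      (x + u) - (y + v)      ∎))

    neg-cong/ : ∀ {x y} → x ≈/ y → - x ≈/ - y
    neg-cong/ {x} {y} (mk≈/ (k , e)) = mk≈/ (- k , (begin
      - k * m        ≈⟨ -‿distribˡ-* k m ⟨
      - (k * m)      ≈⟨ -‿cong e ⟩
      - (x - y)      ≈⟨ -‿+-comm x (- y) ⟨
      - x - - y      ∎))

    *-congˡ/ : ∀ x {u v} → u ≈/ v → x * u ≈/ x * v
    *-congˡ/ x {u} {v} (mk≈/ (k , e)) = mk≈/ (x * k , (begin
      (x * k) * m        ≈⟨ *-assoc x k m ⟩
      x * (k * m)        ≈⟨ *-congˡ e ⟩
      x * (u - v)        ≈⟨ distribˡ x u (- v) ⟩
      x * u + x * - v    ≈⟨ +-congˡ (-‿distribʳ-* x v) ⟨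
      x * u - x * v      ∎))

    *-cong/ : ∀ {x y u v} → x ≈/ y → u ≈/ v → x * u ≈/ y * v
    *-cong/ {x} {y} {u} {v} e e′ =
      trans/ (*-congˡ/ x e′)
        (trans/ (≈⇒≈/ (*-comm x v)) (trans/ (*-congˡ/ v e) (≈⇒≈/ (*-comm v y))))

  quotientRing : CommutativeRing c (c ⊔ ℓ)
  quotientRing = record
    { Carrier = Carrier ; _≈_ = _≈/_
    ; _+_ = _+_ ; _*_ = _*_ ; -_ = -_ ; 0# = 0# ; 1# = 1#
    ; isCommutativeRing = record
      { isRing = record
        { +-isAbelianGroup = record
          { isGroup = record
            { isMonoid = record
              { isSemigroup = record
                { isMagma = record
                  { isEquivalence = record
                    { refl = ≈⇒≈/ refl ; sym = sym/ ; trans = trans/ }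
                  ; ∙-cong = +-cong/ }
                ; assoc = λ x y z → ≈⇒≈/ (+-assoc x y z) }
              ; identity = (λ x → ≈⇒≈/ (+-identityˡ x)) , (λ x → ≈⇒≈/ (+-identityʳ x)) }
            ; inverse = (λ x → ≈⇒≈/ (-‿inverseˡ x)) , (λ x → ≈⇒≈/ (-‿inverseʳ x))
            ; ⁻¹-cong = neg-cong/ }
          ; comm = λ x y → ≈⇒≈/ (+-comm x y) }
        ; *-cong = *-cong/
        ; *-assoc = λ x y z → ≈⇒≈/ (*-assoc x y z)
        ; *-identity = (λ x → ≈⇒≈/ (*-identityˡ x)) , (λ x → ≈⇒≈/ (*-identityʳ x))
        ; distrib = (λ x y z → ≈⇒≈/ (distribˡ x y z)) , (λ x y z → ≈⇒≈/ (distribʳ x y z)) }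
      ; *-comm = λ x y → ≈⇒≈/ (*-comm x y) } }

infix 9 _/⟨_⟩

_/⟨_⟩ : (R : CommutativeRing c ℓ) → CommutativeRing.Carrier R → CommutativeRing c (c ⊔ ℓ)
R /⟨ m ⟩ = Quotient.quotientRing R m

ℤ/_ : ℕ → CommutativeRing 0ℓ 0ℓ
ℤ/ n = ℤ.+-*-commutativeRing /⟨ + n ⟩

------------------------------------------------------------------------
-- Polynomials in one variable

-- A polynomial is its list of coefficients, constant term first; trailing
-- zero coefficients are allowed and are ignored by the equality.

module Polynomial (A : CommutativeRing c ℓ) where

  private
    module A = CommutativeRing A
    open A using (Carrier; _≈_; _+_; _*_; -_; 0#; 1#)
    open RingProperties A.ring using (-0#≈0#)
    open CommutativeSemigroupProperties A.+-commutativeSemigroup using (interchange)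

  Poly : Set c
  Poly = List Carrier

  coeff : Poly → ℕ → Carrier
  coeff []      n       = 0#
  coeff (a ∷ f) zero    = a
  coeff (a ∷ f) (suc n) = coeff f n

  infix 4 _≈ₚ_

  record _≈ₚ_ (f g : Poly) : Set ℓ where
    constructor mk≈ₚ
    field
      coeff-≈ : ∀ n → coeff f n ≈ coeff g n

  infixl 6 _+ₚ_
  infixl 7 _*ₚ_ _·ₚ_

  _+ₚ_ : Poly → Poly → Poly
  []      +ₚ g       = g
  (a ∷ f) +ₚ []      = a ∷ f
  (a ∷ f) +ₚ (b ∷ g) = (a + b) ∷ (f +ₚ g)

  -ₚ_ : Poly → Poly
  -ₚ_ = map -_

  _·ₚ_ : Carrier → Poly → Poly
  a ·ₚ f = map (a *_) f

  _*ₚ_ : Poly → Poly → Poly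
  []      *ₚ g = []
  (a ∷ f) *ₚ g = (a ·ₚ g) +ₚ (0# ∷ (f *ₚ g))

  -- Leading coefficient 1 in degree r.
  record Monic (r : ℕ) (f : Poly) : Set ℓ where
    field
      leading-coeff : coeff f r ≈ 1#
      higher-coeffs : ∀ n → r ℕ.< n → coeff f n ≈ 0#

  open _≈ₚ_ using (coeff-≈)

  reflₚ : ∀ {f} → f ≈ₚ f
  reflₚ = mk≈ₚ λ n → A.refl

  symₚ : ∀ {f g} → f ≈ₚ g → g ≈ₚ f
  symₚ e = mk≈ₚ λ n → A.sym (coeff-≈ e n)

  transₚ : ∀ {f g h} → f ≈ₚ g → g ≈ₚ h → f ≈ₚ h
  transₚ e e′ = mk≈ₚ λ n → A.trans (coeff-≈ e n) (coeff-≈ e′ n)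

  ∷-cong : ∀ {a b f g} → a ≈ b → f ≈ₚ g → (a ∷ f) ≈ₚ (b ∷ g)
  ∷-cong e e′ = mk≈ₚ λ { zero → e ; (suc n) → coeff-≈ e′ n }

  coeff-+ : ∀ f g n → coeff (f +ₚ g) n ≈ coeff f n + coeff g n
  coeff-+ []      g       n       = A.sym (A.+-identityˡ _)
  coeff-+ (a ∷ f) []      n       = A.sym (A.+-identityʳ _)
  coeff-+ (a ∷ f) (b ∷ g) zero    = A.refl
  coeff-+ (a ∷ f) (b ∷ g) (suc n) = coeff-+ f g n

  coeff-neg : ∀ f n → coeff (-ₚ f) n ≈ - coeff f n
  coeff-neg []      n       = A.sym -0#≈0#
  coeff-neg (a ∷ f) zero    = A.refl
  coeff-neg (a ∷ f) (suc n) = coeff-neg f n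

  coeff-· : ∀ a f n → coeff (a ·ₚ f) n ≈ a * coeff f n
  coeff-· a []      n       = A.sym (A.zeroʳ a)
  coeff-· a (b ∷ f) zero    = A.refl
  coeff-· a (b ∷ f) (suc n) = coeff-· a f n

  +-congₚ : ∀ {f f′ g g′} → f ≈ₚ f′ → g ≈ₚ g′ → f +ₚ g ≈ₚ f′ +ₚ g′
  +-congₚ {f} {f′} {g} {g′} e e′ = mk≈ₚ λ n →
    A.trans (coeff-+ f g n)
      (A.trans (A.+-cong (coeff-≈ e n) (coeff-≈ e′ n)) (A.sym (coeff-+ f′ g′ n)))

  +-assocₚ : ∀ f g h → (f +ₚ g) +ₚ h ≈ₚ f +ₚ (g +ₚ h)
  +-assocₚ f g h = mk≈ₚ λ n →
    A.trans (coeff-+ (f +ₚ g) h n)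
    (A.trans (A.+-congʳ (coeff-+ f g n))
    (A.trans (A.+-assoc _ _ _)
    (A.trans (A.+-congˡ (A.sym (coeff-+ g h n))) (A.sym (coeff-+ f (g +ₚ h) n)))))

  +-commₚ : ∀ f g → f +ₚ g ≈ₚ g +ₚ f
  +-commₚ f g = mk≈ₚ λ n →
    A.trans (coeff-+ f g n) (A.trans (A.+-comm _ _) (A.sym (coeff-+ g f n)))

  +-identityʳₚ : ∀ f → f +ₚ [] ≈ₚ f
  +-identityʳₚ f = +-commₚ f []

  +-inverseʳₚ : ∀ f → f +ₚ (-ₚ f) ≈ₚ []
  +-inverseʳₚ f = mk≈ₚ λ n →
    A.trans (coeff-+ f (-ₚ f) n)
      (A.trans (A.+-congˡ (coeff-neg f n)) (A.-‿inverseʳ _))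

  neg-congₚ : ∀ {f g} → f ≈ₚ g → -ₚ f ≈ₚ -ₚ g
  neg-congₚ {f} {g} e = mk≈ₚ λ n →
    A.trans (coeff-neg f n) (A.trans (A.-‿cong (coeff-≈ e n)) (A.sym (coeff-neg g n)))

  interchangeₚ : ∀ f g h k → (f +ₚ g) +ₚ (h +ₚ k) ≈ₚ (f +ₚ h) +ₚ (g +ₚ k)
  interchangeₚ f g h k = mk≈ₚ λ n →
    A.trans (sum₄ f g h k n) (A.trans (interchange _ _ _ _) (A.sym (sum₄ f h g k n)))
    where
    sum₄ : ∀ f g h k n → coeff ((f +ₚ g) +ₚ (h +ₚ k)) n
                       ≈ (coeff f n + coeff g n) + (coeff h n + coeff k n)
    sum₄ f g h k n = A.trans (coeff-+ (f +ₚ g) (h +ₚ k) n)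
                             (A.+-cong (coeff-+ f g n) (coeff-+ h k n))

  ·-cong : ∀ {a b f g} → a ≈ b → f ≈ₚ g → a ·ₚ f ≈ₚ b ·ₚ g
  ·-cong {a} {b} {f} {g} e e′ = mk≈ₚ λ n →
    A.trans (coeff-· a f n) (A.trans (A.*-cong e (coeff-≈ e′ n)) (A.sym (coeff-· b g n)))

  ·-zero : ∀ f → 0# ·ₚ f ≈ₚ []
  ·-zero f = mk≈ₚ λ n → A.trans (coeff-· 0# f n) (A.zeroˡ _)

  ·-one : ∀ f → 1# ·ₚ f ≈ₚ f
  ·-one f = mk≈ₚ λ n → A.trans (coeff-· 1# f n) (A.*-identityˡ _)

  ·-distribˡ : ∀ a f g → a ·ₚ (f +ₚ g) ≈ₚ (a ·ₚ f) +ₚ (a ·ₚ g)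
  ·-distribˡ a f g = mk≈ₚ λ n →
    A.trans (coeff-· a (f +ₚ g) n)
    (A.trans (A.*-congˡ (coeff-+ f g n))
    (A.trans (A.distribˡ _ _ _)
    (A.trans (A.+-cong (A.sym (coeff-· a f n)) (A.sym (coeff-· a g n)))
             (A.sym (coeff-+ (a ·ₚ f) (a ·ₚ g) n)))))

  ·-distribʳ : ∀ a b f → (a + b) ·ₚ f ≈ₚ (a ·ₚ f) +ₚ (b ·ₚ f)
  ·-distribʳ a b f = mk≈ₚ λ n →
    A.trans (coeff-· (a + b) f n)
    (A.trans (A.distribʳ _ _ _)
    (A.trans (A.+-cong (A.sym (coeff-· a f n)) (A.sym (coeff-· b f n)))
             (A.sym (coeff-+ (a ·ₚ f) (b ·ₚ f) n))))

  ·-assoc : ∀ a b f → (a * b) ·ₚ f ≈ₚ a ·ₚ (b ·ₚ f)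
  ·-assoc a b f = mk≈ₚ λ n →
    A.trans (coeff-· (a * b) f n)
    (A.trans (A.*-assoc _ _ _)
    (A.trans (A.*-congˡ (A.sym (coeff-· b f n))) (A.sym (coeff-· a (b ·ₚ f) n))))

  0∷[]≈[] : (0# ∷ []) ≈ₚ []
  0∷[]≈[] = mk≈ₚ λ { zero → A.refl ; (suc n) → A.refl }

  0∷-+ : ∀ f g → (0# ∷ (f +ₚ g)) ≈ₚ (0# ∷ f) +ₚ (0# ∷ g)
  0∷-+ f g = ∷-cong (A.sym (A.+-identityˡ 0#)) reflₚ

  *-zeroʳₚ : ∀ f → f *ₚ [] ≈ₚ []
  *-zeroʳₚ []      = reflₚ
  *-zeroʳₚ (a ∷ f) = transₚ (∷-cong A.refl (*-zeroʳₚ f)) 0∷[]≈[]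

  *-∷ʳ : ∀ f b g → f *ₚ (b ∷ g) ≈ₚ (b ·ₚ f) +ₚ (0# ∷ (f *ₚ g))
  *-∷ʳ []      b g = symₚ 0∷[]≈[]
  *-∷ʳ (a ∷ f) b g = ∷-cong (A.+-congʳ (A.*-comm a b))
    (transₚ (+-congₚ {a ·ₚ g} reflₚ (*-∷ʳ f b g))
    (transₚ (symₚ (+-assocₚ (a ·ₚ g) (b ·ₚ f) _))
    (transₚ (+-congₚ (+-commₚ (a ·ₚ g) (b ·ₚ f)) reflₚ)
            (+-assocₚ (b ·ₚ f) (a ·ₚ g) _))))

  *-commₚ : ∀ f g → f *ₚ g ≈ₚ g *ₚ f
  *-commₚ []      g = symₚ (*-zeroʳₚ g)
  *-commₚ (a ∷ f) g = transₚ
    (+-congₚ {a ·ₚ g} reflₚ (∷-cong A.refl (*-commₚ f g)))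
    (symₚ (*-∷ʳ g a f))

  *-congˡₚ : ∀ f {g h} → g ≈ₚ h → f *ₚ g ≈ₚ f *ₚ h
  *-congˡₚ []      e = reflₚ
  *-congˡₚ (a ∷ f) e = +-congₚ (·-cong A.refl e) (∷-cong A.refl (*-congˡₚ f e))

  *-congₚ : ∀ {f f′ g g′} → f ≈ₚ f′ → g ≈ₚ g′ → f *ₚ g ≈ₚ f′ *ₚ g′
  *-congₚ {f} {f′} {g} {g′} e e′ =
    transₚ (*-congˡₚ f e′)
      (transₚ (*-commₚ f g′) (transₚ (*-congˡₚ g′ e) (*-commₚ g′ f′)))

  *-distribʳₚ : ∀ h f g → (f +ₚ g) *ₚ h ≈ₚ (f *ₚ h) +ₚ (g *ₚ h)
  *-distribʳₚ h []      g       = reflₚ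
  *-distribʳₚ h (a ∷ f) []      = symₚ (+-identityʳₚ _)
  *-distribʳₚ h (a ∷ f) (b ∷ g) = transₚ
    (+-congₚ (·-distribʳ a b h)
             (transₚ (∷-cong A.refl (*-distribʳₚ h f g)) (0∷-+ (f *ₚ h) (g *ₚ h))))
    (interchangeₚ (a ·ₚ h) (b ·ₚ h) _ _)

  *-distribˡₚ : ∀ h f g → h *ₚ (f +ₚ g) ≈ₚ (h *ₚ f) +ₚ (h *ₚ g)
  *-distribˡₚ h f g = transₚ (*-commₚ h (f +ₚ g))
    (transₚ (*-distribʳₚ h f g) (+-congₚ (*-commₚ f h) (*-commₚ g h)))

  ·-* : ∀ a f g → (a ·ₚ f) *ₚ g ≈ₚ a ·ₚ (f *ₚ g)
  ·-* a []      g = reflₚ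
  ·-* a (b ∷ f) g = transₚ
    (+-congₚ (·-assoc a b g) (∷-cong (A.sym (A.zeroʳ a)) (·-* a f g)))
    (symₚ (·-distribˡ a (b ·ₚ g) (0# ∷ (f *ₚ g))))

  *-assocₚ : ∀ f g h → (f *ₚ g) *ₚ h ≈ₚ f *ₚ (g *ₚ h)
  *-assocₚ []      g h = reflₚ
  *-assocₚ (a ∷ f) g h = transₚ
    (*-distribʳₚ h (a ·ₚ g) (0# ∷ (f *ₚ g)))
    (+-congₚ (·-* a g h)
      (transₚ (+-congₚ (·-zero h) reflₚ) (∷-cong A.refl (*-assocₚ f g h))))

  *-identityˡₚ : ∀ f → (1# ∷ []) *ₚ f ≈ₚ f
  *-identityˡₚ f = transₚ (+-congₚ (·-one f) 0∷[]≈[]) (+-identityʳₚ f)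

  polynomialRing : CommutativeRing c ℓ
  polynomialRing = record
    { Carrier = Poly ; _≈_ = _≈ₚ_
    ; _+_ = _+ₚ_ ; _*_ = _*ₚ_ ; -_ = -ₚ_ ; 0# = [] ; 1# = 1# ∷ []
    ; isCommutativeRing = record
      { isRing = record
        { +-isAbelianGroup = record
          { isGroup = record
            { isMonoid = record
              { isSemigroup = record
                { isMagma = record
                  { isEquivalence = record
                    { refl = reflₚ ; sym = symₚ ; trans = transₚ }
                  ; ∙-cong = +-congₚ }
                ; assoc = +-assocₚ }
              ; identity = (λ f → reflₚ) , +-identityʳₚ }
            ; inverse = (λ f → transₚ (+-commₚ (-ₚ f) f) (+-inverseʳₚ f)) , +-inverseʳₚ
            ; ⁻¹-cong = neg-congₚ }
          ; comm = +-commₚ }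
        ; *-cong = *-congₚ
        ; *-assoc = *-assocₚ
        ; *-identity = *-identityˡₚ
                     , (λ f → transₚ (*-commₚ f (1# ∷ [])) (*-identityˡₚ f))
        ; distrib = *-distribˡₚ , *-distribʳₚ }
      ; *-comm = *-commₚ } }

open Polynomial public using (Poly; coeff; Monic; polynomialRing)

_[X] : CommutativeRing c ℓ → CommutativeRing c ℓ
A [X] = polynomialRing A

------------------------------------------------------------------------
-- Designs

-- A collection of blocks may contain repetitions, so it is a family of
-- subsets of the point set indexed by `Block`.

record Design (p p′ b b′ i : Level) : Set (ℓsuc (p ⊔ p′ ⊔ b ⊔ b′ ⊔ i)) where
  field
    Point  : Setoid p p′
    Block  : Setoid b b′
    _∈ᵇ_   : Setoid.Carrier Point → Setoid.Carrier Block → Set i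
    ∈ᵇ-resp : ∀ {x y B B′} → Setoid._≈_ Point x y → Setoid._≈_ Block B B′ →
              x ∈ᵇ B → y ∈ᵇ B′

-- A bijection of the point sets carrying the collection of blocks of 𝒟 onto
-- that of ℰ, with multiplicities: `blocks` names, for each block B of 𝒟,
-- the block of ℰ that is the image of B under `points`.

record _≅_ (𝒟 : Design p p′ b b′ i) (ℰ : Design q q′ d d′ j)
           : Set (p ⊔ p′ ⊔ b ⊔ b′ ⊔ i ⊔ q ⊔ q′ ⊔ d ⊔ d′ ⊔ j) where
  private
    module 𝒟 = Design 𝒟
    module ℰ = Design ℰ
  field
    points : Inverse 𝒟.Point ℰ.Point
    blocks : Inverse 𝒟.Block ℰ.Block
    image  : ∀ x B → (x 𝒟.∈ᵇ B) ⇔ (Inverse.to points x ℰ.∈ᵇ Inverse.to blocks B)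

module _ (G : AbelianGroup c ℓ) where

  open AbelianGroup G

  dev : {I : Set a} → (I → Pred Carrier p) → Design c ℓ (a ⊔ c) (a ⊔ ℓ) (c ⊔ ℓ ⊔ p)
  dev {I = I} D = record
    { Point   = setoid
    ; Block   = ≡.setoid I ×ₛ setoid
    ; _∈ᵇ_    = λ { x (i , g) → ∃ λ y → D i y × x ≈ y ∙ g }
    ; ∈ᵇ-resp = λ { x≈x′ (≡.refl , g≈g′) (y , y∈D , x≈yg) →
                    y , y∈D , trans (sym x≈x′) (trans x≈yg (∙-congˡ g≈g′)) }
    }

------------------------------------------------------------------------
-- The finite field family

record IsFieldOfOrder (F : CommutativeRing c ℓ) (n : ℕ) : Set (c ⊔ ℓ) where
  open CommutativeRing F
  field
    1≉0     : ¬ (1# ≈ 0#)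
    inverse : ∀ x → ¬ (x ≈ 0#) → ∃ λ y → x * y ≈ 1#
    order   : Inverse setoid (≡.setoid (Fin n))

module _ (R : CommutativeRing c ℓ) where

  open CommutativeRing R
  open RingDefs R using (_^_) renaming (_×_ to _·_)

  record GeneratesUnits (α : Carrier) : Set (c ⊔ ℓ) where
    field
      nonzero   : ¬ (α ≈ 0#)
      generates : ∀ x → ¬ (x ≈ 0#) → ∃ λ t → x ≈ α ^ t

  -- C_i = {α^t : t ≡ i (mod e)}; exponents t ≥ 0 suffice as α has finite order.
  cyclotomicClass : (α : Carrier) (e : ℕ) .{{_ : ℕ.NonZero e}} → Fin e → Pred Carrier ℓ
  cyclotomicClass α e i x = ∃ λ t → t % e ≡ toℕ i × x ≈ α ^ t

  record HasMultiplicativeOrder (ξ : Carrier) (n : ℕ) : Set ℓ where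
    field
      ξ^n≈1   : ξ ^ n ≈ 1#
      minimal : ∀ m → 0 ℕ.< m → m ℕ.< n → ¬ (ξ ^ m ≈ 1#)

  -- The Teichmüller set {0, 1, ξ, …, ξ^(n-1)}, where ξ has order n.
  teichmüller : (ξ : Carrier) (n : ℕ) → Fin (suc n) → Carrier
  teichmüller ξ n zero    = 0#
  teichmüller ξ n (suc i) = ξ ^ toℕ i

  Teichmüller : (ξ : Carrier) (n : ℕ) → Pred Carrier ℓ
  Teichmüller ξ n x = ∃ λ i → x ≈ teichmüller ξ n i

  Teichmüller* : (ξ : Carrier) (n : ℕ) → Pred Carrier ℓ
  Teichmüller* ξ n x = Teichmüller ξ n x × ¬ (x ≈ 0#)

  -- The sets (1 + pα)𝒯* for α ∈ 𝒯 (`just`), together with p𝒯* (`nothing`).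
  teichmüllerFamily : (p : ℕ) (ξ : Carrier) (n : ℕ) → Maybe (Fin (suc n)) → Pred Carrier (c ⊔ ℓ)
  teichmüllerFamily p ξ n (just i) x =
    ∃ λ t → Teichmüller* ξ n t × x ≈ (1# + p · teichmüller ξ n i) * t
  teichmüllerFamily p ξ n nothing x =
    ∃ λ t → Teichmüller* ξ n t × x ≈ p · t

------------------------------------------------------------------------
-- Galois rings of characteristic p²

-- ℤ/ n has carrier ℤ for every n, so a polynomial over ℤ/ p² and its
-- reduction modulo p are the same list of integers.

record IsBasicIrreducible (p r : ℕ) (f : List ℤ) : Set where
  field
    monic       : Monic (ℤ/ (p ℕ.^ 2)) r f
    irreducible : RingDefs.Irreducible ((ℤ/ p) [X]) f

GR : (p : ℕ) (f : List ℤ) → CommutativeRing 0ℓ 0ℓ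
GR p f = ((ℤ/ (p ℕ.^ 2)) [X]) /⟨ f ⟩

------------------------------------------------------------------------
-- The two developments

dev-C : (F : CommutativeRing c ℓ) (α : CommutativeRing.Carrier F) (p r : ℕ) →
        Design c ℓ c ℓ (c ⊔ ℓ)
dev-C F α p r =
  dev (CommutativeRing.+-abelianGroup F) (cyclotomicClass F α (suc (p ℕ.^ r)))

dev-E : (p r : ℕ) (f : List ℤ) (ξ : CommutativeRing.Carrier (GR p f)) →
        Design 0ℓ 0ℓ 0ℓ 0ℓ 0ℓ
dev-E p r f ξ =
  dev (CommutativeRing.+-abelianGroup (GR p f)) (teichmüllerFamily (GR p f) p ξ (p ℕ.^ r ∸ 1))

module Submission where

-- The blocks of dev(C) are the lines of AG(2, q), q = p ^ r, each punctured
-- at one of its points (its centre).  Suppose that q > 3 and that dev(E) also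
-- arises from a linear space in this way.  Multiplication by ξ is an
-- automorphism of dev(E) preserving the block 𝒯*, so it fixes the centre u of
-- 𝒯*.  If u were nonzero, then the images of a block through 0 and u under
-- the powers of ξ would be q - 1 distinct blocks through 0 and u, one too
-- many; hence u = 0.  Puncturing the line 𝒯 at 1 instead of 0 yields y such
-- that y (s - 1) ∈ 𝒯* for all s ∈ 𝒯* other than 1.  Comparing s = ξ with
-- s = ξ⁻¹ gives -1 ∈ 𝒯*, and then (s - 1)(s + 1) = s² - 1 gives y ∈ 𝒯*.  So 𝒯
-- is closed under addition and contains p; but p is a nonzero nilpotent while
-- the nonzero elements of 𝒯 are units.  For q = 3 both designs consist of all
-- the pairs of nine points.

open import Algebra.Bundles using (CommutativeRing)
import Algebra.Definitions.RawMagma as RawMagma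
import Algebra.Properties.CommutativeMonoid.Sum
import Algebra.Properties.CommutativeSemiring.Binomial
import Algebra.Properties.CommutativeSemiring.Exp
import Algebra.Properties.Ring
import Algebra.Properties.Semiring.Mult
import Algebra.Properties.Semiring.Mult.TCOptimised
open import Algebra.Solver.Ring.AlmostCommutativeRing using (fromCommutativeRing; _-Raw-AlmostCommutative⟶_)
open import Data.Fin.Base as Fin using (Fin; zero; suc; toℕ; fromℕ; fromℕ<; inject₁)
open import Data.Fin.Patterns using (0F; 1F; 2F; 3F; 4F; 5F; 6F; 7F; 8F)
import Data.Fin.Properties as Fin
open import Data.Integer.Base as ℤ using (ℤ; +_; -[1+_])
open import Data.Integer.DivMod as ℤ using (_%ℕ_; _/ℕ_)
import Data.Integer.Properties as ℤ
open import Data.List.Base using (List; []; _∷_)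
open import Data.Maybe.Base using (Maybe; just; nothing)
open import Data.Nat.Base as ℕ using (ℕ; zero; suc; _%_; _/_; s≤s; z≤n; _!)
open import Data.Nat.Combinatorics using (_C_; nCn≡1; nCk≡n!/k![n-k]!; k![n∸k]!∣n!)
open import Data.Nat.DivMod using (_mod_; m≡m%n+[m/n]*n; m%n<n; m/n*n≡m; [m+kn]%n≡m%n; m<n⇒m%n≡m)
open import Data.Nat.Divisibility using (_∣_; divides; ∣m⇒∣m*n; ∣⇒≤)
open import Data.Nat.Primality using (Prime; prime?; euclidsLemma; prime⇒irreducible; prime⇒nonTrivial; prime⇒nonZero)
import Data.Nat.Properties as ℕ
open import Data.Product.Base using (∃; ∃₂; _×_; _,_; proj₁; proj₂)
open import Data.Product.Relation.Binary.Pointwise.NonDependent using (_×ₛ_)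
open import Data.Sum.Base as Sum using (_⊎_; inj₁; inj₂)
open import Data.Unit.Base using (⊤; tt)
open import Function.Bundles using (Inverse; Equivalence; _⇔_; mk⇔; mk↔ₛ′)
import Function.Construct.Composition as Composition
import Function.Construct.Identity as Identity
import Function.Construct.Symmetry as Symmetry
open import Level using (Level; _⊔_)
open import Relation.Binary.Bundles using (Setoid)
open import Relation.Binary.Definitions using (Decidable; tri<; tri≈; tri>)
open import Relation.Binary.PropositionalEquality as ≡ using (_≡_)
open import Relation.Nullary using (¬_; yes; no; contradiction)
open import Relation.Nullary.Decidable using (toWitness)
open import Relation.Unary using (Pred)
open import Defs

-- A centre does not belong to its own block, so it is not clear at first that multiplication by ξ
-- respects the centres: a centre is seen only through other blocks, as the one point missing on the
-- line that its block spans. This is why `ξu≈u` and `multiplier` compare 𝒯* with a second puncture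
-- of the same line, and why blocks need at least three points, that is, q > 3. An isomorphism also
-- carries over the size of the blocks, and this supplies inequalities in the ring such as `p≉0`. On
-- the other side, dev(C) has the required shape because a coset of the subgroup of order q - 1,
-- together with 0, is the solution set of x ^ q = x * c for some constant c. By Frobenius this set
-- is an additive group.

private
  variable
    a c ℓ c′ ℓ′ δ p p′ b b′ i q q′ ε ε′ j : Level
    n : ℕ

-- A ring solver with integer coefficients, and the pigeonhole principle for setoids

module IntegerMultiples {c ℓ} (R : CommutativeRing c ℓ) where

  open CommutativeRing R
  open Algebra.Properties.Ring ring
  open Algebra.Properties.Semiring.Mult.TCOptimised semiring renaming (_×_ to _·_)
  open import Relation.Binary.Reasoning.Setoid setoid

  -- With the optimised multiples `⟦ + 1 ⟧ℤ` computes to `1#`, so `con (+ 1)` can stand for `1#` in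
  -- solver goals.
  ⟦_⟧ℤ : ℤ → Carrier
  ⟦ + n ⟧ℤ      = n · 1#
  ⟦ -[1+ n ] ⟧ℤ = - (suc n · 1#)

  ⊖-homo : ∀ m n → ⟦ m ℤ.⊖ n ⟧ℤ ≈ m · 1# - n · 1#
  ⊖-homo m       zero    = sym (trans (+-congˡ -0#≈0#) (+-identityʳ _))
  ⊖-homo zero    (suc n) = sym (+-identityˡ _)
  ⊖-homo (suc m) (suc n) = begin
    ⟦ suc m ℤ.⊖ suc n ⟧ℤ                ≡⟨ ≡.cong ⟦_⟧ℤ (ℤ.[1+m]⊖[1+n]≡m⊖n m n) ⟩
    ⟦ m ℤ.⊖ n ⟧ℤ                        ≈⟨ ⊖-homo m n ⟩
    m · 1# - n · 1#                     ≈⟨ +-congʳ (xyx⁻¹≈y 1# (m · 1#)) ⟨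
    (1# + m · 1# - 1#) - n · 1#         ≈⟨ +-assoc _ _ _ ⟩
    (1# + m · 1#) + (- 1# - n · 1#)     ≈⟨ +-congˡ (-‿+-comm 1# (n · 1#)) ⟩
    (1# + m · 1#) - (1# + n · 1#)       ≈⟨ +-cong (1+× m 1#) (-‿cong (1+× n 1#)) ⟨
    suc m · 1# - suc n · 1#             ∎

  neg-homo : ∀ i → ⟦ ℤ.- i ⟧ℤ ≈ - ⟦ i ⟧ℤ
  neg-homo (+ zero)   = sym -0#≈0#
  neg-homo (+ suc n)  = refl
  neg-homo -[1+ n ]   = sym (-‿involutive _)

  +-homo : ∀ i j → ⟦ i ℤ.+ j ⟧ℤ ≈ ⟦ i ⟧ℤ + ⟦ j ⟧ℤ
  +-homo (+ m)    (+ n)    = ×-homo-+ 1# m n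
  +-homo (+ m)    -[1+ n ] = ⊖-homo m (suc n)
  +-homo -[1+ m ] (+ n)    = trans (⊖-homo n (suc m)) (+-comm _ _)
  +-homo -[1+ m ] -[1+ n ] = begin
    - (suc (suc (m ℕ.+ n)) · 1#)     ≡⟨ ≡.cong (λ k → - (k · 1#)) (≡.cong suc (≡.sym (ℕ.+-suc m n))) ⟩
    - ((suc m ℕ.+ suc n) · 1#)       ≈⟨ -‿cong (×-homo-+ 1# (suc m) (suc n)) ⟩
    - (suc m · 1# + suc n · 1#)      ≈⟨ -‿+-comm _ _ ⟨
    - (suc m · 1#) - suc n · 1#      ∎

  *-homo-+ : ∀ m j → ⟦ + m ℤ.* j ⟧ℤ ≈ ⟦ + m ⟧ℤ * ⟦ j ⟧ℤ
  *-homo-+ zero    j = sym (zeroˡ _)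
  *-homo-+ (suc m) j = begin
    ⟦ + suc m ℤ.* j ⟧ℤ               ≡⟨ ≡.cong ⟦_⟧ℤ (ℤ.suc-* (+ m) j) ⟩
    ⟦ j ℤ.+ + m ℤ.* j ⟧ℤ             ≈⟨ +-homo j (+ m ℤ.* j) ⟩
    ⟦ j ⟧ℤ + ⟦ + m ℤ.* j ⟧ℤ          ≈⟨ +-cong (sym (*-identityˡ _)) (*-homo-+ m j) ⟩
    1# * ⟦ j ⟧ℤ + m · 1# * ⟦ j ⟧ℤ    ≈⟨ distribʳ _ _ _ ⟨
    (1# + m · 1#) * ⟦ j ⟧ℤ           ≈⟨ *-congʳ (1+× m 1#) ⟨
    suc m · 1# * ⟦ j ⟧ℤ              ∎

  *-homo : ∀ i j → ⟦ i ℤ.* j ⟧ℤ ≈ ⟦ i ⟧ℤ * ⟦ j ⟧ℤ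
  *-homo (+ m)    j = *-homo-+ m j
  *-homo -[1+ m ] j = begin
    ⟦ -[1+ m ] ℤ.* j ⟧ℤ              ≡⟨ ≡.cong ⟦_⟧ℤ (ℤ.neg-distribˡ-* (+ suc m) j) ⟨
    ⟦ ℤ.- (+ suc m ℤ.* j) ⟧ℤ         ≈⟨ neg-homo (+ suc m ℤ.* j) ⟩
    - ⟦ + suc m ℤ.* j ⟧ℤ             ≈⟨ -‿cong (*-homo-+ (suc m) j) ⟩
    - (suc m · 1# * ⟦ j ⟧ℤ)          ≈⟨ -‿distribˡ-* _ _ ⟩
    - (suc m · 1#) * ⟦ j ⟧ℤ          ∎

  homomorphism : ℤ.+-*-rawRing -Raw-AlmostCommutative⟶ fromCommutativeRing R
  homomorphism = record
    { ⟦_⟧ = ⟦_⟧ℤ ; +-homo = +-homo ; *-homo = *-homo ; -‿homo = neg-homo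
    ; 0-homo = refl ; 1-homo = refl }

  ⟦⟧-≟ : ∀ i j → Maybe (⟦ i ⟧ℤ ≈ ⟦ j ⟧ℤ)
  ⟦⟧-≟ i j with i ℤ.≟ j
  ... | yes ≡.refl = just refl
  ... | no  _      = nothing

-- With integer coefficients, unlike coefficients in R itself, the solver
-- recognises cancellations such as x - x.

module IntegerSolver {c ℓ} (R : CommutativeRing c ℓ) where

  open IntegerMultiples R using (homomorphism; ⟦⟧-≟)
  open import Algebra.Solver.Ring ℤ.+-*-rawRing (fromCommutativeRing R) homomorphism ⟦⟧-≟ public
    using (solve; _:=_; con; _:+_; _:*_; _:-_; :-_)

module _ (S : Setoid a ℓ) where

  open Setoid S renaming (Carrier to A)

  pigeonhole : ∀ {m} (P : Pred A p) (cover : Fin m → A) → (∀ z → P z → ∃ λ k → z ≈ cover k) →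
               m ℕ.< n → (f : Fin n → A) → (∀ i → P (f i)) → ∃₂ λ i j → i Fin.< j × f i ≈ f j
  pigeonhole P cover covers m<n f f∈P
    with i , j , i<j , same ← Fin.pigeonhole m<n (λ i → proj₁ (covers (f i) (f∈P i)))
    = i , j , i<j , trans (proj₂ (covers (f i) (f∈P i)))
        (trans (reflexive (≡.cong cover same)) (sym (proj₂ (covers (f j) (f∈P j)))))

-- Punctured linear spaces and their transport along isomorphisms

-- Designs whose blocks are the lines of a linear space, each with one of
-- its points (the centre of the block) removed.

record PuncturedLines (𝒟 : Design p p′ b b′ i) (n : ℕ) : Set (p ⊔ p′ ⊔ b ⊔ b′ ⊔ i) where
  open Design 𝒟
  open Setoid Point renaming (Carrier to P; _≈_ to _≈ₚ_) using () public
  open Setoid Block renaming (Carrier to B; _≈_ to _≈ᵇ_) using () public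
  infix 4 _≟_
  field
    -- Part of the structure so that an isomorphism hands decidable equality from the finite field
    -- to the Galois ring, where the argument splits on `u ≟ 0#`.
    _≟_    : Decidable _≈ₚ_
    centre : B → P

  infix 4 _∈ˡ_
  _∈ˡ_ : P → B → Set (p′ ⊔ i)
  z ∈ˡ X = z ∈ᵇ X ⊎ z ≈ₚ centre X

  field
    centre∉   : ∀ X → ¬ centre X ∈ᵇ X
    join      : ∀ {x y} → ¬ x ≈ₚ y → ∃ λ X → x ∈ᵇ X × y ∈ᵇ X
    same-line : ∀ {x y X Y} → ¬ x ≈ₚ y → x ∈ᵇ X → y ∈ᵇ X → x ∈ᵇ Y → y ∈ᵇ Y →
                ∀ {z} → z ∈ˡ Y → z ∈ˡ X
    unique    : ∀ {x y X Y} → ¬ x ≈ₚ y → x ∈ᵇ X → y ∈ᵇ X → x ∈ᵇ Y → y ∈ᵇ Y →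
                centre X ≈ₚ centre Y → X ≈ᵇ Y
    puncture  : ∀ {t X} → t ∈ᵇ X → ∃ λ Y → ∀ z → z ∈ᵇ Y ⇔ (z ∈ˡ X × ¬ z ≈ₚ t)
    -- A lower bound for the block size. Carried over to dev(E), it yields `scale-free` and through
    -- it `p≉0`.
    points    : ∀ X → Fin n → P
    points-∈  : ∀ X k → points X k ∈ᵇ X
    points-injective : ∀ X {k l} → points X k ≈ₚ points X l → k ≡ l

module Transport {𝒟 : Design p p′ b b′ i} {ℰ : Design q q′ ε ε′ j} (iso : 𝒟 ≅ ℰ) where

  private
    module 𝒟 = Design 𝒟
    module ℰ = Design ℰ
    module P𝒟 = Setoid 𝒟.Point
    module B𝒟 = Setoid 𝒟.Block
    module Pℰ = Setoid ℰ.Point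
    module Bℰ = Setoid ℰ.Block
    open _≅_ iso
    module φ = Inverse points
    module ψ = Inverse blocks

    φ-injective : ∀ {x y} → φ.to x Pℰ.≈ φ.to y → x P𝒟.≈ y
    φ-injective eq = P𝒟.trans (P𝒟.sym (φ.inverseʳ Pℰ.refl)) (φ.inverseʳ eq)

    φ⁻¹-injective : ∀ {x y} → φ.from x P𝒟.≈ φ.from y → x Pℰ.≈ y
    φ⁻¹-injective eq = Pℰ.trans (Pℰ.sym (φ.inverseˡ P𝒟.refl)) (φ.inverseˡ eq)

    push : ∀ {x X} → x 𝒟.∈ᵇ ψ.from X → φ.to x ℰ.∈ᵇ X
    push x∈X = ℰ.∈ᵇ-resp Pℰ.refl (ψ.inverseˡ B𝒟.refl) (Equivalence.to (image _ _) x∈X)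

    pull : ∀ {x X} → x ℰ.∈ᵇ X → φ.from x 𝒟.∈ᵇ ψ.from X
    pull x∈X = Equivalence.from (image _ _)
      (ℰ.∈ᵇ-resp (Pℰ.sym (φ.inverseˡ P𝒟.refl)) (Bℰ.sym (ψ.inverseˡ B𝒟.refl)) x∈X)

    pull⁻¹ : ∀ {x X} → φ.from x 𝒟.∈ᵇ ψ.from X → x ℰ.∈ᵇ X
    pull⁻¹ x∈X = ℰ.∈ᵇ-resp (φ.inverseˡ P𝒟.refl) Bℰ.refl (push x∈X)

    pull≉ : ∀ {x y} → ¬ x Pℰ.≈ y → ¬ φ.from x P𝒟.≈ φ.from y
    pull≉ x≉y eq = x≉y (φ⁻¹-injective eq)

  puncturedLines : PuncturedLines 𝒟 n → PuncturedLines ℰ n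
  puncturedLines 𝓛 = record
    { _≟_       = _≟′_
    ; centre    = λ X → φ.to (centre (ψ.from X))
    ; centre∉   = λ X c∈X → centre∉ (ψ.from X)
                    (𝒟.∈ᵇ-resp (φ.inverseʳ Pℰ.refl) B𝒟.refl (pull c∈X))
    ; join      = join′
    ; same-line = λ x≉y x∈X y∈X x∈Y y∈Y z∈Y →
                    pullˡ⁻¹ (same-line (pull≉ x≉y) (pull x∈X) (pull y∈X) (pull x∈Y) (pull y∈Y) (pullˡ z∈Y))
    ; unique    = λ {_} {_} {X} {Y} x≉y x∈X y∈X x∈Y y∈Y eq →
                    ψ⁻¹-injective (unique (pull≉ x≉y) (pull x∈X) (pull y∈X) (pull x∈Y) (pull y∈Y) (φ-injective eq))
    ; puncture  = puncture′
    ; points    = λ X k → φ.to (pts (ψ.from X) k)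
    ; points-∈  = λ X k → push (points-∈ (ψ.from X) k)
    ; points-injective = λ X eq → points-injective (ψ.from X) (φ-injective eq)
    }
    where
    open PuncturedLines 𝓛 renaming (points to pts)

    _≟′_ : Decidable Pℰ._≈_
    x ≟′ y with φ.from x ≟ φ.from y
    ... | yes eq = yes (φ⁻¹-injective eq)
    ... | no neq = no λ eq → neq (φ.from-cong eq)

    ψ⁻¹-injective : ∀ {X Y} → ψ.from X B𝒟.≈ ψ.from Y → X Bℰ.≈ Y
    ψ⁻¹-injective eq = Bℰ.trans (Bℰ.sym (ψ.inverseˡ B𝒟.refl)) (ψ.inverseˡ eq)

    pullˡ : ∀ {z X} → z ℰ.∈ᵇ X ⊎ z Pℰ.≈ φ.to (centre (ψ.from X)) → φ.from z ∈ˡ ψ.from X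
    pullˡ = Sum.map pull φ.inverseʳ

    pullˡ⁻¹ : ∀ {z X} → φ.from z ∈ˡ ψ.from X → z ℰ.∈ᵇ X ⊎ z Pℰ.≈ φ.to (centre (ψ.from X))
    pullˡ⁻¹ = Sum.map pull⁻¹ (λ eq → Pℰ.sym (φ.inverseˡ (P𝒟.sym eq)))

    join′ : ∀ {x y} → ¬ x Pℰ.≈ y → ∃ λ X → x ℰ.∈ᵇ X × y ℰ.∈ᵇ X
    join′ x≉y with X , x∈X , y∈X ← join (pull≉ x≉y) =
      ψ.to X ,
      ℰ.∈ᵇ-resp (φ.inverseˡ P𝒟.refl) Bℰ.refl (Equivalence.to (image _ _) x∈X) ,
      ℰ.∈ᵇ-resp (φ.inverseˡ P𝒟.refl) Bℰ.refl (Equivalence.to (image _ _) y∈X)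

    puncture′ : ∀ {t X} → t ℰ.∈ᵇ X → ∃ λ Y → ∀ z →
                z ℰ.∈ᵇ Y ⇔ ((z ℰ.∈ᵇ X ⊎ z Pℰ.≈ φ.to (centre (ψ.from X))) × ¬ z Pℰ.≈ t)
    puncture′ {t} {X} t∈X with Y , Y⇔ ← puncture (pull t∈X) = ψ.to Y , λ z → mk⇔
      (λ z∈Y → let z∈ˡX , z≉t = Equivalence.to (Y⇔ (φ.from z))
                     (𝒟.∈ᵇ-resp P𝒟.refl (ψ.inverseʳ Bℰ.refl) (pull z∈Y))
               in pullˡ⁻¹ z∈ˡX , λ eq → z≉t (φ.from-cong eq))
      (λ (z∈ˡX , z≉t) → ℰ.∈ᵇ-resp (φ.inverseˡ P𝒟.refl) Bℰ.refl
        (Equivalence.to (image _ _) (Equivalence.from (Y⇔ _) (pullˡ z∈ˡX , pull≉ z≉t))))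

-- Partitions of the nonzero elements into punctured additive subgroups

record Spread (R : CommutativeRing c ℓ) {I : Set a} (D : I → Pred (CommutativeRing.Carrier R) δ)
              (n : ℕ) : Set (c ⊔ ℓ ⊔ a ⊔ δ) where
  open CommutativeRing R hiding (zero)
  infix 4 _≟_
  field
    _≟_      : Decidable _≈_
    resp     : ∀ {i x y} → x ≈ y → D i x → D i y
    nonzero  : ∀ {i x} → D i x → ¬ x ≈ 0#
    closed-  : ∀ {i x y} → D i x ⊎ x ≈ 0# → D i y ⊎ y ≈ 0# → D i (x - y) ⊎ x - y ≈ 0#
    cover    : ∀ x → ¬ x ≈ 0# → ∃ λ i → D i x
    disjoint : ∀ {i j x} → D i x → D j x → i ≡ j
    points   : I → Fin n → Carrier
    points-∈ : ∀ i k → D i (points i k)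
    points-injective : ∀ i {k l} → points i k ≈ points i l → k ≡ l

module _ {R : CommutativeRing c ℓ} {I : Set a} {D : I → Pred (CommutativeRing.Carrier R) δ}
         (𝓢 : Spread R D (suc (suc n))) where

  open CommutativeRing R hiding (zero)
  open Spread 𝓢
  open IntegerSolver R
  open Design (dev +-abelianGroup D)
  open import Algebra.Properties.Ring ring

  private
    D₀ : I → Pred Carrier _
    D₀ i x = D i x ⊎ x ≈ 0#

    resp₀ : ∀ {i x y} → x ≈ y → D₀ i x → D₀ i y
    resp₀ x≈y = Sum.map (resp x≈y) (trans (sym x≈y))

    closed+ : ∀ {i x y} → D₀ i x → D₀ i y → D₀ i (x + y)
    closed+ {i} {x} {y} x∈ y∈ =
      resp₀ (solve 2 (λ x y → x :- (con (+ 0) :- y) := x :+ y) refl x y)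
        (closed- x∈ (closed- (inj₂ refl) y∈))

    remove-0 : ∀ {i x} → D₀ i x → ¬ x ≈ 0# → D i x
    remove-0 (inj₁ x∈)  _   = x∈
    remove-0 (inj₂ x≈0) x≉0 = contradiction x≈0 x≉0

    ∈⇒diff : ∀ {i g x} → x ∈ᵇ (i , g) → D i (x - g)
    ∈⇒diff {g = g} (y , y∈D , x≈y+g) =
      resp (trans (solve 2 (λ y g → y := (y :+ g) :- g) refl y g) (+-congʳ (sym x≈y+g))) y∈D

    diff⇒∈ : ∀ {i g x} → D i (x - g) → x ∈ᵇ (i , g)
    diff⇒∈ {g = g} {x} x-g∈D = x - g , x-g∈D , solve 2 (λ x g → x := (x :- g) :+ g) refl x g

    ∈ˡ⇒diff : ∀ {i g x} → x ∈ᵇ (i , g) ⊎ x ≈ g → D₀ i (x - g)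
    ∈ˡ⇒diff = Sum.map ∈⇒diff x≈y⇒x∙y⁻¹≈ε

    diff⇒∈ˡ : ∀ {i g x} → D₀ i (x - g) → x ∈ᵇ (i , g) ⊎ x ≈ g
    diff⇒∈ˡ = Sum.map diff⇒∈ (x∙y⁻¹≈ε⇒x≈y _ _)

    cancel : ∀ x y z → (x - z) - (y - z) ≈ x - y
    cancel = solve 3 (λ x y z → (x :- z) :- (y :- z) := x :- y) refl

    -- Both D i and D j contain the nonzero difference `x - y`.
    parallel : ∀ {x y i j g h} → ¬ x ≈ y → x ∈ᵇ (i , g) → y ∈ᵇ (i , g) → x ∈ᵇ (j , h) → y ∈ᵇ (j , h) → i ≡ j
    parallel {x} {y} x≉y x∈X y∈X x∈Y y∈Y = disjoint (direction x∈X y∈X) (direction x∈Y y∈Y)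
      where
      direction : ∀ {i g} → x ∈ᵇ (i , g) → y ∈ᵇ (i , g) → D i (x - y)
      direction x∈ y∈ = remove-0 (resp₀ (cancel _ _ _) (closed- (inj₁ (∈⇒diff x∈)) (inj₁ (∈⇒diff y∈))))
        λ eq → x≉y (x∙y⁻¹≈ε⇒x≈y _ _ eq)

    other : ∀ i z → ∃ λ y → D i y × ¬ y ≈ z
    other i z with points i zero ≟ z
    ... | no neq  = points i zero , points-∈ i zero , neq
    ... | yes eq₀ = points i (suc zero) , points-∈ i (suc zero) , λ eq₁ →
      contradiction (points-injective i (trans eq₀ (sym eq₁))) λ ()

  -- The block D i + g is the coset of the subgroup D i ∪ {0} through g, without g itself. So the
  -- translating element is the centre, and puncturing at t means representing the same coset by t.
  spread-puncturedLines : PuncturedLines (dev +-abelianGroup D) (suc (suc n))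
  spread-puncturedLines = record
    { _≟_       = _≟_
    ; centre    = proj₂
    ; centre∉   = λ (i , g) g∈ → nonzero (∈⇒diff g∈) (-‿inverseʳ g)
    ; join      = join
    ; same-line = same-line
    ; unique    = λ x≉y x∈X y∈X x∈Y y∈Y g≈h → parallel x≉y x∈X y∈X x∈Y y∈Y , g≈h
    ; puncture  = λ {t} {X} t∈X → (proj₁ X , t) , λ z → mk⇔
        (λ z∈ → diff⇒∈ˡ (resp₀ (chain z t (proj₂ X)) (closed+ (inj₁ (∈⇒diff z∈)) (inj₁ (∈⇒diff t∈X))))
              , λ z≈t → nonzero (∈⇒diff z∈) (x≈y⇒x∙y⁻¹≈ε z≈t))
        (λ (z∈ , z≉t) → diff⇒∈ (remove-0 (resp₀ (cancel _ _ _) (closed- (∈ˡ⇒diff z∈) (inj₁ (∈⇒diff t∈X))))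
              λ eq → z≉t (x∙y⁻¹≈ε⇒x≈y _ _ eq)))
    ; points    = λ (i , g) k → points i k + g
    ; points-∈  = λ (i , g) k → points i k , points-∈ i k , refl
    ; points-injective = λ (i , g) eq → points-injective i (+-cancelʳ g _ _ eq)
    }
    where
    chain : ∀ x y z → (x - y) + (y - z) ≈ x - z
    chain = solve 3 (λ x y z → (x :- y) :+ (y :- z) := x :- z) refl

    join : ∀ {x y} → ¬ x ≈ y → ∃ λ X → x ∈ᵇ X × y ∈ᵇ X
    join {x} {y} x≉y
      with i , x-y∈D ← cover (x - y) (λ eq → x≉y (x∙y⁻¹≈ε⇒x≈y _ _ eq))
      with u , u∈D , u≉y-x ← other i (y - x) =
      -- Any point of the line through x and y other than these two can be the centre. The point y -
      -- u is one, since u is neither 0 nor y - x; that such a u exists uses two elements of D i.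
      (i , y - u) ,
      diff⇒∈ (resp (solve 3 (λ x y u → (x :- y) :+ u := x :- (y :- u)) refl x y u)
        (remove-0 (closed+ (inj₁ x-y∈D) (inj₁ u∈D)) λ eq → u≉y-x (x∙y⁻¹≈ε⇒x≈y _ _
          (trans (solve 3 (λ x y u → u :- (y :- x) := (x :- y) :+ u) refl x y u) eq)))) ,
      diff⇒∈ (resp (solve 2 (λ y u → u := y :- (y :- u)) refl y u) u∈D)

    same-line : ∀ {x y X Y} → ¬ x ≈ y → x ∈ᵇ X → y ∈ᵇ X → x ∈ᵇ Y → y ∈ᵇ Y →
                ∀ {z} → z ∈ᵇ Y ⊎ z ≈ proj₂ Y → z ∈ᵇ X ⊎ z ≈ proj₂ X
    same-line {x} {y} {i , g} {j , h} x≉y x∈X y∈X x∈Y y∈Y {z} z∈Y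
      with ≡.refl ← parallel x≉y x∈X y∈X x∈Y y∈Y =
      diff⇒∈ˡ (resp₀ (solve 4 (λ x z g h → ((z :- h) :- (x :- h)) :+ (x :- g) := z :- g) refl x z g h)
        (closed+ (closed- (∈ˡ⇒diff z∈Y) (inj₁ (∈⇒diff x∈Y))) (inj₁ (∈⇒diff x∈X))))

-- Periodicity of powers, and the Teichmüller family in terms of powers of ξ

module Powers (R : CommutativeRing c ℓ) where

  open CommutativeRing R hiding (zero)
  open Algebra.Properties.CommutativeSemiring.Exp commutativeSemiring
  open import Relation.Binary.Reasoning.Setoid setoid

  1^n≈1 : ∀ n → 1# ^ n ≈ 1#
  1^n≈1 zero    = refl
  1^n≈1 (suc n) = trans (*-identityˡ _) (1^n≈1 n)

  -- The factor `a` is kept because it may be a zero divisor, such as `p · 1#`, and then cannot be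
  -- cancelled from a x = a.
  absorb-^ : ∀ {a x} → a * x ≈ a → ∀ k → a * x ^ k ≈ a
  absorb-^         ax≈a zero    = *-identityʳ _
  absorb-^ {a} {x} ax≈a (suc k) = trans (sym (*-assoc a x (x ^ k))) (trans (*-congʳ ax≈a) (absorb-^ ax≈a k))

  absorb-% : ∀ {a x} k .{{_ : ℕ.NonZero k}} → a * x ^ k ≈ a → ∀ l → a * x ^ l ≈ a * x ^ (l % k)
  absorb-% {a} {x} k ax^k≈a l = begin
    a * x ^ l                                 ≡⟨ ≡.cong (λ l → a * x ^ l) (≡.trans (m≡m%n+[m/n]*n l k) (ℕ.+-comm (l % k) _)) ⟩
    a * x ^ ((l / k) ℕ.* k ℕ.+ l % k)          ≈⟨ *-congˡ (^-homo-* x ((l / k) ℕ.* k) (l % k)) ⟩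
    a * (x ^ ((l / k) ℕ.* k) * x ^ (l % k))    ≈⟨ *-assoc _ _ _ ⟨
    a * x ^ ((l / k) ℕ.* k) * x ^ (l % k)      ≡⟨ ≡.cong (λ l′ → a * x ^ l′ * x ^ (l % k)) (ℕ.*-comm (l / k) k) ⟩
    a * x ^ (k ℕ.* (l / k)) * x ^ (l % k)      ≈⟨ *-congʳ (*-congˡ (^-assocʳ x k (l / k))) ⟨
    a * (x ^ k) ^ (l / k) * x ^ (l % k)        ≈⟨ *-congʳ (absorb-^ ax^k≈a (l / k)) ⟩
    a * x ^ (l % k)                           ∎

  ^-% : ∀ {x} n .{{_ : ℕ.NonZero n}} → x ^ n ≈ 1# → ∀ k → x ^ k ≈ x ^ (k % n)
  ^-% n x^n≈1 k = trans (sym (*-identityˡ _)) (trans (absorb-% n (trans (*-identityˡ _) x^n≈1) k) (*-identityˡ _))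

  ^-inverse : ∀ {x} n → x ^ suc n ≈ 1# → ∀ k → x ^ k * x ^ (k ℕ.* n) ≈ 1#
  ^-inverse {x} n x^n≈1 k = begin
    x ^ k * x ^ (k ℕ.* n)     ≈⟨ ^-homo-* x k (k ℕ.* n) ⟨
    x ^ (k ℕ.+ k ℕ.* n)       ≡⟨ ≡.cong (x ^_) (≡.trans (≡.sym (ℕ.*-suc k n)) (ℕ.*-comm k (suc n))) ⟩
    x ^ (suc n ℕ.* k)         ≈⟨ ^-assocʳ x (suc n) k ⟨
    (x ^ suc n) ^ k           ≈⟨ ^-congˡ k x^n≈1 ⟩
    1# ^ k                    ≈⟨ 1^n≈1 k ⟩
    1#                        ∎

module TeichmüllerFamily (R : CommutativeRing c ℓ) (p : ℕ) {n : ℕ} .{{n≢0 : ℕ.NonZero n}}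
  (ξ : CommutativeRing.Carrier R) (ξ-order : HasMultiplicativeOrder R ξ n) (1<n : 1 ℕ.< n) where

  open CommutativeRing R hiding (zero)
  open Algebra.Properties.CommutativeSemiring.Exp commutativeSemiring
  open Algebra.Properties.Semiring.Mult semiring renaming (_×_ to _·_)
  open HasMultiplicativeOrder ξ-order
  open Powers R

  ξ^≈ξ^% : ∀ k → ξ ^ k ≈ ξ ^ (k % n)
  ξ^≈ξ^% = ^-% n ξ^n≈1

  invert : ∀ k → ξ ^ k * ξ ^ (k ℕ.* ℕ.pred n) ≈ 1#
  invert = ^-inverse (ℕ.pred n) (trans (reflexive (≡.cong (ξ ^_) (ℕ.suc-pred n))) ξ^n≈1)

  1≉0 : ¬ 1# ≈ 0#
  1≉0 1≈0 = minimal 1 (s≤s z≤n) 1<n (trans (trivial _) (sym (trivial _)))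
    where
    trivial : ∀ x → x ≈ 0#
    trivial x = trans (sym (*-identityʳ x)) (trans (*-congˡ 1≈0) (zeroʳ x))

  ξ^≉0 : ∀ k → ¬ ξ ^ k ≈ 0#
  ξ^≉0 k eq = 1≉0 (trans (sym (invert k)) (trans (*-congʳ eq) (zeroˡ _)))

  -- Every set of the family, p𝒯* included, is `scale i` times the powers of ξ, so the two kinds of
  -- sets can be treated alike.
  scale : Maybe (Fin (suc n)) → Carrier
  scale (just i) = 1# + p · teichmüller R ξ n i
  scale nothing  = p · 1#

  teichmüller*⇒power : ∀ {t} → Teichmüller* R ξ n t → ∃ λ k → t ≈ ξ ^ k
  teichmüller*⇒power ((zero  , t≈0)  , t≉0) = contradiction t≈0 t≉0
  teichmüller*⇒power ((suc i , t≈ξ^) , _)   = toℕ i , t≈ξ^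

  power⇒teichmüller* : ∀ k → Teichmüller* R ξ n (ξ ^ k)
  power⇒teichmüller* k =
    (suc (k mod n) , trans (ξ^≈ξ^% k) (reflexive (≡.cong (ξ ^_) (≡.sym (Fin.toℕ-fromℕ< (m%n<n k n)))))) ,
    ξ^≉0 k

  p·≈ : ∀ t → (p · 1#) * t ≈ p · t
  p·≈ t = trans (×-assoc-* p 1# t) (×-congʳ p (*-identityˡ t))

  family⇒power : ∀ i {x} → teichmüllerFamily R p ξ n i x → ∃ λ k → x ≈ scale i * ξ ^ k
  family⇒power (just i) (t , t∈T* , x≈) with k , t≈ ← teichmüller*⇒power t∈T* = k , trans x≈ (*-congˡ t≈)
  family⇒power nothing  (t , t∈T* , x≈) with k , t≈ ← teichmüller*⇒power t∈T* =
    k , trans x≈ (trans (sym (p·≈ t)) (*-congˡ t≈))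

  power⇒family : ∀ i {x} k → x ≈ scale i * ξ ^ k → teichmüllerFamily R p ξ n i x
  power⇒family (just i) k x≈ = ξ ^ k , power⇒teichmüller* k , x≈
  power⇒family nothing  k x≈ = ξ ^ k , power⇒teichmüller* k , trans x≈ (p·≈ (ξ ^ k))

  -- Unlike membership in dev, which unfolds, this record determines its point
  -- and block, so that they can be left implicit.
  record _∈ᵖ_ (x : Carrier) (X : Maybe (Fin (suc n)) × Carrier) : Set ℓ where
    constructor power
    field
      exponent : ℕ
      equation : x ≈ scale (proj₁ X) * ξ ^ exponent + proj₂ X

  powerDesign : Design c ℓ c ℓ ℓ
  powerDesign = record
    { Point   = setoid
    ; Block   = ≡.setoid _ ×ₛ setoid
    ; _∈ᵇ_    = _∈ᵖ_
    ; ∈ᵇ-resp = λ { x≈x′ (≡.refl , g≈g′) (power k x≈) →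
                    power k (trans (sym x≈x′) (trans x≈ (+-congˡ g≈g′))) }
    }

  dev≅powerDesign : dev +-abelianGroup (teichmüllerFamily R p ξ n) ≅ powerDesign
  dev≅powerDesign = record
    { points = Identity.inverse setoid
    ; blocks = Identity.inverse (≡.setoid _ ×ₛ setoid)
    ; image  = λ x (i , g) → mk⇔
        (λ (y , y∈ , x≈) → let k , y≈ = family⇒power i y∈ in power k (trans x≈ (+-congʳ y≈)))
        (λ (power k x≈) → scale i * ξ ^ k , power⇒family i k refl , x≈)
    }

-- For q > 3, dev(E) does not consist of punctured lines

module _ (R : CommutativeRing c ℓ) (p : ℕ) {m : ℕ} (ξ : CommutativeRing.Carrier R)
  (ξ-order : HasMultiplicativeOrder R ξ (3 ℕ.+ m)) where

  open CommutativeRing R hiding (zero)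
  open Algebra.Properties.CommutativeSemiring.Exp commutativeSemiring
  open Algebra.Properties.Semiring.Mult semiring renaming (_×_ to _·_)
  open Algebra.Properties.Ring ring
  open HasMultiplicativeOrder ξ-order
  open Powers R
  open TeichmüllerFamily R p ξ ξ-order (s≤s (s≤s z≤n))
  open IntegerSolver R
  open import Relation.Binary.Reasoning.Setoid setoid

  private
    N = 3 ℕ.+ m
    open Design powerDesign renaming (_∈ᵇ_ to infix 4 _∈ᵇ_)

  module _ (𝓛 : PuncturedLines powerDesign N) where

    open PuncturedLines 𝓛

    private
      U : Pred Carrier ℓ
      U x = ∃ λ k → x ≈ ξ ^ k

      U-resp : ∀ {x y} → x ≈ y → U x → U y
      U-resp x≈y (k , x≈) = k , trans (sym x≈y) x≈

      U-* : ∀ {x y} → U x → U y → U (x * y)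
      U-* (k , x≈) (l , y≈) = k ℕ.+ l , trans (*-cong x≈ y≈) (sym (^-homo-* ξ k l))

      U-inverse : ∀ {x} → U x → ∃ λ y → U y × x * y ≈ 1#
      U-inverse (k , x≈) = ξ ^ (k ℕ.* (2 ℕ.+ m)) , (k ℕ.* (2 ℕ.+ m) , refl) , trans (*-congʳ x≈) (invert k)

      U-cancel : ∀ {s x y} → U s → s * x ≈ s * y → x ≈ y
      U-cancel {s} {x} {y} Us sx≈sy with s⁻¹ , _ , ss⁻¹≈1 ← U-inverse Us = begin
        x              ≈⟨ *-identityˡ x ⟨
        1# * x         ≈⟨ *-congʳ ss⁻¹≈1 ⟨
        s * s⁻¹ * x    ≈⟨ solve 3 (λ s t x → s :* t :* x := t :* (s :* x)) refl s s⁻¹ x ⟩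
        s⁻¹ * (s * x)  ≈⟨ *-congˡ sx≈sy ⟩
        s⁻¹ * (s * y)  ≈⟨ solve 3 (λ s t x → s :* t :* x := t :* (s :* x)) refl s s⁻¹ y ⟨
        s * s⁻¹ * y    ≈⟨ *-congʳ ss⁻¹≈1 ⟩
        1# * y         ≈⟨ *-identityˡ y ⟩
        y              ∎

      U-divide : ∀ {s x} → U s → U (s * x) → U x
      U-divide {s} {x} Us Usx with s⁻¹ , Us⁻¹ , ss⁻¹≈1 ← U-inverse Us = U-resp (begin
        s⁻¹ * (s * x)  ≈⟨ solve 3 (λ s t x → s :* t :* x := t :* (s :* x)) refl s s⁻¹ x ⟨
        s * s⁻¹ * x    ≈⟨ *-congʳ ss⁻¹≈1 ⟩
        1# * x         ≈⟨ *-identityˡ x ⟩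
        x              ∎)
        (U-* Us⁻¹ Usx)

      Uξ : U ξ
      Uξ = 1 , sym (*-identityʳ ξ)

      U1 : U 1#
      U1 = 0 , refl

      ξ≉1 : ¬ ξ ≈ 1#
      ξ≉1 eq = minimal 1 (s≤s z≤n) (s≤s (s≤s z≤n)) (trans (*-identityʳ ξ) eq)

      ξξ≉1 : ¬ ξ * ξ ≈ 1#
      ξξ≉1 eq = minimal 2 (s≤s z≤n) (s≤s (s≤s (s≤s z≤n))) (trans (*-congˡ (*-identityʳ ξ)) eq)

      -- Otherwise the powers of ξ would repeat with period k on `scale i`, and the block would have
      -- at most k < N points.
      scale-free : ∀ i k → 0 ℕ.< k → k ℕ.< N → ¬ scale i * ξ ^ k ≈ scale i
      scale-free i k 0<k k<N eq =
        let _ , _ , k<l , same = pigeonhole setoid (_∈ᵇ (i , 0#)) cover covers k<N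
                                   (points (i , 0#)) (points-∈ (i , 0#))
        in Fin.<-irrefl (points-injective (i , 0#) same) k<l
        where
        instance _ = ℕ.>-nonZero 0<k
        cover : Fin k → Carrier
        cover j = scale i * ξ ^ toℕ j + 0#
        covers : ∀ z → z ∈ᵇ (i , 0#) → ∃ λ j → z ≈ cover j
        covers z (power l z≈) = l mod k ,
          trans z≈ (+-congʳ (trans (absorb-% k eq l)
            (reflexive (≡.cong (λ j → scale i * ξ ^ j) (≡.sym (Fin.toℕ-fromℕ< (m%n<n l k)))))))

      rotate : ∀ {x i g} k → x ∈ᵇ (i , g) → ξ ^ k * x ∈ᵇ (i , ξ ^ k * g)
      rotate {x} {i} {g} k (power l x≈) = power (k ℕ.+ l) (begin
        ξ ^ k * x                                ≈⟨ *-congˡ x≈ ⟩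
        ξ ^ k * (scale i * ξ ^ l + g)            ≈⟨ solve 4 (λ s t a g → s :* (a :* t :+ g) := a :* (s :* t) :+ s :* g) refl (ξ ^ k) (ξ ^ l) (scale i) g ⟩
        scale i * (ξ ^ k * ξ ^ l) + ξ ^ k * g    ≈⟨ +-congʳ (*-congˡ (^-homo-* ξ k l)) ⟨
        scale i * ξ ^ (k ℕ.+ l) + ξ ^ k * g      ∎)

      T* : B
      T* = just zero , 0#

      scale₀≈1 : scale (just zero) ≈ 1#
      scale₀≈1 = trans (+-congˡ (trans (sym (p·≈ 0#)) (zeroʳ _))) (+-identityʳ 1#)

      U⇒∈ : ∀ {x} → U x → x ∈ᵇ T*
      U⇒∈ (k , x≈) = power k (trans x≈ (sym (trans (+-identityʳ _) (trans (*-congʳ scale₀≈1) (*-identityˡ _)))))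

      ∈⇒U : ∀ {x} → x ∈ᵇ T* → U x
      ∈⇒U (power k x≈) =
        k , trans x≈ (trans (+-identityʳ _) (trans (*-congʳ scale₀≈1) (*-identityˡ _)))

      u : Carrier
      u = centre T*

      ¬Uu : ¬ U u
      ¬Uu Uu = centre∉ T* (U⇒∈ Uu)

      -- The line of 𝒯* punctured at 1 is a block containing ξ, ξ² and u. Its multiple by ξ contains
      -- ξ², ξ³ and ξu, and shares the two distinct points ξ² and ξ³ with 𝒯*. Hence ξu lies on the
      -- line of 𝒯*; it is not in 𝒯*, since u would then be too, so it is the centre.
      ξu≈u : ξ * u ≈ u
      ξu≈u with puncture {X = T*} (U⇒∈ U1)
      ... | (i , g) , Y⇔ = Sum.[ (λ ξu∈T* → contradiction (U-divide Uξ (∈⇒U ξu∈T*)) ¬Uu) , (λ eq → eq) ]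
        (same-line ξξ≉ξξξ (U⇒∈ (U-* Uξ Uξ)) (U⇒∈ (U-* Uξ (U-* Uξ Uξ)))
          (rotated (inj₁ (U⇒∈ Uξ)) ξ≉1) (rotated (inj₁ (U⇒∈ (U-* Uξ Uξ))) ξξ≉1)
          (inj₁ (rotated (inj₂ refl) λ eq → ¬Uu (U-resp (sym eq) U1))))
        where
        rotated : ∀ {x} → x ∈ˡ T* → ¬ x ≈ 1# → ξ * x ∈ᵇ (i , ξ ^ 1 * g)
        rotated x∈ x≉1 = ∈ᵇ-resp (*-congʳ (*-identityʳ ξ)) (≡.refl , refl) (rotate 1 (Equivalence.from (Y⇔ _) (x∈ , x≉1)))
        ξξ≉ξξξ : ¬ ξ * ξ ≈ ξ * (ξ * ξ)
        ξξ≉ξξξ eq = ξ≉1 (sym (U-cancel (U-* Uξ Uξ) (trans (*-identityʳ _) (trans eq (sym (*-assoc ξ ξ ξ))))))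

      -- As 0 is in the block, g = - `scale i` ξ ^ j for some j. An equation g = ξ ^ d g therefore
      -- gives `scale i` ξ ^ d = `scale i`, against `scale-free`.
      translates-distinct : ∀ {i g k l} → 0# ∈ᵇ (i , g) → k ℕ.< l → l ℕ.< N → ¬ ξ ^ k * g ≈ ξ ^ l * g
      translates-distinct {i} {g} {k} {l} (power j 0≈) k<l l<N eq =
        scale-free i (l ℕ.∸ k) (ℕ.m<n⇒0<n∸m k<l) (ℕ.≤-<-trans (ℕ.m∸n≤m l k) l<N)
          (U-cancel (j , refl) (begin
            ξ ^ j * (scale i * ξ ^ d)           ≈⟨ solve 4 (λ s t a g → s :* (a :* t) := (a :* s :+ g) :* t :- t :* g) refl (ξ ^ j) (ξ ^ d) (scale i) g ⟩
            (scale i * ξ ^ j + g) * ξ ^ d - ξ ^ d * g ≈⟨ +-cong (*-congʳ (sym 0≈)) (-‿cong (sym g≈)) ⟩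
            0# * ξ ^ d - g                      ≈⟨ solve 2 (λ t g → con (+ 0) :* t :- g := con (+ 0) :- g) refl (ξ ^ d) g ⟩
            0# - g                              ≈⟨ +-congʳ 0≈ ⟩
            scale i * ξ ^ j + g - g             ≈⟨ solve 3 (λ s a g → (a :* s :+ g) :- g := s :* a) refl (ξ ^ j) (scale i) g ⟩
            ξ ^ j * scale i                     ∎))
        where
        d = l ℕ.∸ k
        g≈ : g ≈ ξ ^ d * g
        g≈ = U-cancel (k , refl) (begin
          ξ ^ k * g               ≈⟨ eq ⟩
          ξ ^ l * g               ≡⟨ ≡.cong (λ l → ξ ^ l * g) (ℕ.m+[n∸m]≡n (ℕ.<⇒≤ k<l)) ⟨
          ξ ^ (k ℕ.+ d) * g       ≈⟨ *-congʳ (^-homo-* ξ k d) ⟩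
          ξ ^ k * ξ ^ d * g       ≈⟨ *-assoc _ _ _ ⟩
          ξ ^ k * (ξ ^ d * g)     ∎)

      -- The count takes place on the line of a block X through 0 and u. The rotated blocks span
      -- this same line, so 0, u and the N centres of these blocks would be N + 2 distinct points on
      -- it, but it has at most N + 1.
      u≈0 : u ≈ 0#
      u≈0 with u ≟ 0#
      ... | yes eq = eq
      ... | no u≉0 with (i , g) , 0∈X , u∈X ← join (λ eq → u≉0 (sym eq)) =
        contradiction (pigeonhole setoid (_∈ˡ (i , g)) cover covers (ℕ.n<1+n _) f f∈X) collision
        where
        translate : Fin N → B
        translate j = i , ξ ^ toℕ j * g
        0∈translate : ∀ j → 0# ∈ᵇ translate j
        0∈translate j = ∈ᵇ-resp (zeroʳ _) (≡.refl , refl) (rotate (toℕ j) 0∈X)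
        u∈translate : ∀ j → u ∈ᵇ translate j
        u∈translate j = ∈ᵇ-resp (trans (*-comm _ _) (absorb-^ (trans (*-comm u ξ) ξu≈u) (toℕ j)))
                          (≡.refl , refl) (rotate (toℕ j) u∈X)
        cover : Fin (suc N) → Carrier
        cover zero    = centre (i , g)
        cover (suc j) = scale i * ξ ^ toℕ j + g
        covers : ∀ z → z ∈ˡ (i , g) → ∃ λ j → z ≈ cover j
        covers z (inj₂ z≈) = zero , z≈
        covers z (inj₁ (power k z≈)) = suc (k mod N) , trans z≈ (+-congʳ (*-congˡ
          (trans (ξ^≈ξ^% k) (reflexive (≡.cong (ξ ^_) (≡.sym (Fin.toℕ-fromℕ< (m%n<n k N))))))))
        f : Fin (2 ℕ.+ N) → Carrier
        f zero          = 0#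
        f (suc zero)    = u
        f (suc (suc j)) = centre (translate j)
        f∈X : ∀ k → f k ∈ˡ (i , g)
        f∈X zero          = inj₁ 0∈X
        f∈X (suc zero)    = inj₁ u∈X
        f∈X (suc (suc j)) = same-line u≉0 u∈X 0∈X (u∈translate j) (0∈translate j) (inj₂ refl)
        centre≉ : ∀ {x} j → x ∈ᵇ translate j → ¬ x ≈ centre (translate j)
        centre≉ j x∈ eq = centre∉ _ (∈ᵇ-resp eq (≡.refl , refl) x∈)
        collision : ¬ ∃₂ λ k l → k Fin.< l × f k ≈ f l
        collision (zero        , suc zero    , _         , eq) = u≉0 (sym eq)
        collision (zero        , suc (suc l) , _         , eq) = centre≉ l (0∈translate l) eq
        collision (suc zero    , suc zero    , s≤s (), eq)
        collision (suc zero    , suc (suc l) , _         , eq) = centre≉ l (u∈translate l) eq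
        collision (suc (suc k) , suc zero    , s≤s (), eq)
        collision (suc (suc k) , suc (suc l) , s≤s (s≤s k<l) , eq) =
          translates-distinct 0∈X k<l (Fin.toℕ<n l)
            (proj₂ (unique u≉0 (u∈translate k) (0∈translate k) (u∈translate l) (0∈translate l) eq))

      -- The line of 𝒯* punctured at 1 is a block `scale i` U + g, and it contains 0 because u = 0.
      -- So g = - y with y in `scale i` U, and the block consists of the elements y (s - 1) with s
      -- in U. These lie in 𝒯* ∪ {0}, and by `scale-free` only s = 1 gives 0.
      multiplier : ∃ λ y → ∀ {s} → U s → ¬ s ≈ 1# → U (y * (s - 1#))
      multiplier with puncture {X = T*} (U⇒∈ U1)
      ... | (i , g) , Y⇔ with Equivalence.from (Y⇔ 0#) (inj₂ (sym u≈0) , λ 0≈1 → 1≉0 (sym 0≈1))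
      ...   | power k 0≈ = y , λ {s} Us s≉1 → in-T* Us s≉1 (proj₁ (Equivalence.to (Y⇔ (y * (s - 1#))) (∈Y Us)))
        where
        y = scale i * ξ ^ k
        ∈Y : ∀ {s} → U s → y * (s - 1#) ∈ᵇ (i , g)
        ∈Y {s} (l , s≈) = power (k ℕ.+ l) (begin
          y * (s - 1#)                          ≈⟨ solve 3 (λ y s g → y :* (s :- con (+ 1)) := y :* s :+ g :- (y :+ g)) refl y s g ⟩
          y * s + g - (y + g)                   ≈⟨ +-congˡ (-‿cong 0≈) ⟨
          y * s + g - 0#                        ≈⟨ trans (+-congˡ -0#≈0#) (+-identityʳ _) ⟩
          y * s + g                             ≈⟨ +-congʳ (*-congˡ s≈) ⟩
          y * ξ ^ l + g                         ≈⟨ +-congʳ (*-assoc _ _ _) ⟩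
          scale i * (ξ ^ k * ξ ^ l) + g         ≈⟨ +-congʳ (*-congˡ (^-homo-* ξ k l)) ⟨
          scale i * ξ ^ (k ℕ.+ l) + g           ∎)
        ys≉y : ∀ {s} → U s → ¬ s ≈ 1# → ¬ y * s ≈ y
        ys≉y {s} (l , s≈) s≉1 eq with l % N in l%N≡
        ... | zero  = s≉1 (trans s≈ (trans (ξ^≈ξ^% l) (reflexive (≡.cong (ξ ^_) l%N≡))))
        ... | suc d = scale-free i (suc d) (s≤s z≤n) (≡.subst (ℕ._< N) l%N≡ (m%n<n l N)) (U-cancel (k , refl) (begin
          ξ ^ k * (scale i * ξ ^ suc d)   ≈⟨ *-congˡ (*-congˡ (trans s≈ (trans (ξ^≈ξ^% l) (reflexive (≡.cong (ξ ^_) l%N≡))))) ⟨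
          ξ ^ k * (scale i * s)           ≈⟨ solve 3 (λ t a s → t :* (a :* s) := a :* t :* s) refl (ξ ^ k) (scale i) s ⟩
          y * s                           ≈⟨ eq ⟩
          y                               ≈⟨ *-comm _ _ ⟩
          ξ ^ k * scale i                 ∎))
        in-T* : ∀ {s} → U s → ¬ s ≈ 1# → y * (s - 1#) ∈ˡ T* → U (y * (s - 1#))
        in-T* Us s≉1 (inj₁ v∈) = ∈⇒U v∈
        in-T* {s} Us s≉1 (inj₂ v≈u) = contradiction
          (x∙y⁻¹≈ε⇒x≈y _ _ (trans (solve 2 (λ y s → y :* s :- y := y :* (s :- con (+ 1))) refl y s) (trans v≈u u≈0)))
          (ys≉y Us s≉1)

      module _ {y} (Uy[s-1] : ∀ {s} → U s → ¬ s ≈ 1# → U (y * (s - 1#))) where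

        -- Since ξ y (ξ⁻¹ - 1) = - y (ξ - 1), the element -1 is a quotient of two elements of U.
        U-1 : U (- 1#)
        U-1 with ξ⁻¹ , Uξ⁻¹ , ξξ⁻¹≈1 ← U-inverse Uξ
            with w , Uw , vw≈1 ← U-inverse (Uy[s-1] Uξ ξ≉1) =
          U-resp (begin
            ξ * (y * (ξ⁻¹ - 1#)) * w                  ≈⟨ solve 4 (λ x x′ y w → x :* (y :* (x′ :- con (+ 1))) :* w := y :* (x :* x′ :- x) :* w) refl ξ ξ⁻¹ y w ⟩
            y * (ξ * ξ⁻¹ - ξ) * w                     ≈⟨ *-congʳ (*-congˡ (+-congʳ ξξ⁻¹≈1)) ⟩
            y * (1# - ξ) * w                          ≈⟨ solve 3 (λ x y w → y :* (con (+ 1) :- x) :* w := :- (y :* (x :- con (+ 1)) :* w)) refl ξ y w ⟩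
            - (y * (ξ - 1#) * w)                      ≈⟨ -‿cong vw≈1 ⟩
            - 1#                                      ∎)
            (U-* (U-* Uξ (Uy[s-1] Uξ⁻¹ λ eq → ξ≉1 (trans (sym (*-identityʳ ξ)) (trans (*-congˡ (sym eq)) ξξ⁻¹≈1)))) Uw)

        U-neg : ∀ {s} → U s → U (- s)
        U-neg Us = U-resp (-1*x≈-x _) (U-* U-1 Us)

        -- In y (ξ - 1) · y (- ξ - 1) = - y · y (ξ² - 1) everything except the single factor y is
        -- known to be in U. That ξ² ≠ 1 allows both s = ξ² and s = - ξ.
        Uy : U y
        Uy with w , Uw , vw≈1 ← U-inverse (Uy[s-1] (U-* Uξ Uξ) ξξ≉1) =
          U-resp (begin
            - (y * (ξ - 1#) * (y * (- ξ - 1#)) * w)   ≈⟨ solve 3 (λ x y w → :- (y :* (x :- con (+ 1)) :* (y :* (:- x :- con (+ 1))) :* w) := y :* (y :* (x :* x :- con (+ 1)) :* w)) refl ξ y w ⟩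
            y * (y * (ξ * ξ - 1#) * w)                ≈⟨ *-congˡ vw≈1 ⟩
            y * 1#                                    ≈⟨ *-identityʳ y ⟩
            y                                         ∎)
            (U-neg (U-* (U-* (Uy[s-1] Uξ ξ≉1) (Uy[s-1] (U-neg Uξ) -ξ≉1)) Uw))
          where
          -ξ≉1 : ¬ - ξ ≈ 1#
          -ξ≉1 eq = ξξ≉1 (trans (solve 1 (λ x → x :* x := :- x :* :- x) refl ξ) (trans (*-cong eq eq) (*-identityˡ 1#)))

        U[s-1] : ∀ {s} → U s → ¬ s ≈ 1# → U (s - 1#)
        U[s-1] Us s≉1 = U-divide Uy (Uy[s-1] Us s≉1)

        -- Adding 1 is negating, subtracting 1 and negating again. The subtraction stays in U unless
        -- - k = 1, and then k + 1 = 0.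
        multiples-of-1 : ∀ k → k · 1# ≈ 0# ⊎ U (k · 1#)
        multiples-of-1 zero    = inj₁ refl
        multiples-of-1 (suc k) with multiples-of-1 k
        ... | inj₁ k≈0 = inj₂ (U-resp (sym (trans (+-congˡ k≈0) (+-identityʳ 1#))) U1)
        ... | inj₂ Uk with - (k · 1#) ≟ 1#
        ...   | yes eq = inj₁ (trans (+-congʳ (sym eq)) (-‿inverseˡ _))
        ...   | no neq = inj₂ (U-resp (solve 1 (λ k → :- (:- k :- con (+ 1)) := con (+ 1) :+ k) refl (k · 1#))
                                (U-neg (U[s-1] (U-neg Uk) neq)))

      -- If p were 0, all points of the block p𝒯* would coincide.
      p≉0 : ¬ p · 1# ≈ 0#
      p≉0 p≈0 = scale-free nothing 1 (s≤s z≤n) (s≤s (s≤s z≤n))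
        (trans (*-congʳ p≈0) (trans (zeroˡ _) (sym p≈0)))

    teichmüller-not-puncturedLines : ¬ (p · 1#) * (p · 1#) ≈ 0#
    teichmüller-not-puncturedLines p²≈0 =
      Sum.[ p≉0 , (λ Up → p≉0 (U-cancel Up (trans p²≈0 (sym (zeroʳ _))))) ]
        (multiples-of-1 (proj₂ multiplier) p)

-- The Frobenius map in characteristic p

prime∤! : ∀ {p} → Prime p → ∀ {k} → k ℕ.< p → ¬ p ∣ k !
prime∤! {p} pp {zero}  _   p∣1 = contradiction (∣⇒≤ p∣1) (ℕ.<⇒≱ (ℕ.nonTrivial⇒n>1 p {{prime⇒nonTrivial pp}}))
prime∤! {p} pp {suc k} k<p p∣ with euclidsLemma (suc k) (k !) pp p∣
... | inj₁ p∣k  = contradiction (∣⇒≤ p∣k) (ℕ.<⇒≱ k<p)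
... | inj₂ p∣k! = prime∤! pp (ℕ.<-trans (ℕ.n<1+n k) k<p) p∣k!

-- The product of the binomial coefficient with k! (p - k)! is p!, which p divides, while p divides
-- neither k! nor (p - k)!.
prime∣C : ∀ {p} → Prime p → ∀ {k} → 0 ℕ.< k → k ℕ.< p → p ∣ p C k
prime∣C {suc p} pp {k} 0<k k<p = Sum.[ (λ p∣C → p∣C) , (λ p∣k![p-k]! → contradiction p∣k![p-k]! p∤k![p-k]!) ]
  (euclidsLemma (suc p C k) (k ! ℕ.* (suc p ℕ.∸ k) !) pp
    (≡.subst (suc p ∣_) (≡.sym C*k![p-k]!≡p!) (∣m⇒∣m*n (p !) (divides 1 (≡.sym (ℕ.*-identityˡ (suc p)))))))
  where
  k≤p = ℕ.<⇒≤ k<p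
  instance _ = ℕ._!*_!≢0 k (suc p ℕ.∸ k)
  C*k![p-k]!≡p! : (suc p C k) ℕ.* (k ! ℕ.* (suc p ℕ.∸ k) !) ≡ suc p !
  C*k![p-k]!≡p! = ≡.trans (≡.cong (ℕ._* (k ! ℕ.* (suc p ℕ.∸ k) !)) (nCk≡n!/k![n-k]! k≤p)) (m/n*n≡m (k![n∸k]!∣n! k≤p))
  p∤k![p-k]! : ¬ suc p ∣ k ! ℕ.* (suc p ℕ.∸ k) !
  p∤k![p-k]! p∣ with euclidsLemma (k !) ((suc p ℕ.∸ k) !) pp p∣
  ... | inj₁ p∣k!     = prime∤! pp k<p p∣k!
  ... | inj₂ p∣[p-k]! = prime∤! pp (ℕ.∸-monoʳ-< 0<k k≤p) p∣[p-k]!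

module Frobenius (R : CommutativeRing c ℓ) {p : ℕ} (p-prime : Prime p) where

  open CommutativeRing R hiding (zero)
  open Algebra.Properties.CommutativeSemiring.Binomial commutativeSemiring using (binomialTerm; theorem)
  open Algebra.Properties.CommutativeSemiring.Exp commutativeSemiring
  open Algebra.Properties.CommutativeMonoid.Sum +-commutativeMonoid
  open Algebra.Properties.Semiring.Mult semiring renaming (_×_ to _·_)
  open import Relation.Binary.Reasoning.Setoid setoid

  module _ (p≈0 : p · 1# ≈ 0#) where

    multiple≈0 : ∀ {k} → p ∣ k → ∀ x → k · x ≈ 0#
    multiple≈0 {k} (divides d ≡.refl) x = begin
      (d ℕ.* p) · x        ≈⟨ ×-assocˡ x d p ⟨
      d · (p · x)          ≈⟨ ×-congʳ d (×-congʳ p (*-identityˡ x)) ⟨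
      d · (p · (1# * x))   ≈⟨ ×-congʳ d (×-assoc-* p 1# x) ⟨
      d · ((p · 1#) * x)   ≈⟨ ×-congʳ d (trans (*-congʳ p≈0) (zeroˡ x)) ⟩
      d · 0#               ≈⟨ sum-replicate d ⟨
      sum {d} (λ _ → 0#)   ≈⟨ sum-replicate-zero d ⟩
      0#                   ∎

    frobenius : ∀ x y → (x + y) ^ p ≈ x ^ p + y ^ p
    frobenius x y = go p ≡.refl
      where
      -- Replacing p by a variable lets it be matched as a successor, which splits the binomial sum
      -- into its first term, the inner terms and its last term.
      go : ∀ k → k ≡ p → (x + y) ^ k ≈ x ^ k + y ^ k
      go zero    ≡.refl = contradiction ≡.refl (ℕ.≢-nonZero⁻¹ p {{prime⇒nonZero p-prime}})
      go (suc k) ≡.refl = begin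
        (x + y) ^ p                                      ≈⟨ theorem p x y ⟩
        t zero + sum (λ i → t (suc i))                   ≈⟨ +-cong first (sum-init-last (λ i → t (suc i))) ⟩
        y ^ p + (sum (λ i → t (suc (inject₁ i))) + t (suc (fromℕ k)))
                                                         ≈⟨ +-congˡ (+-cong (trans (sum-cong-≋ {k} middle) (sum-replicate-zero k)) last) ⟩
        y ^ p + (0# + x ^ p)                             ≈⟨ +-congˡ (+-identityˡ _) ⟩
        y ^ p + x ^ p                                    ≈⟨ +-comm _ _ ⟩
        x ^ p + y ^ p                                    ∎
        where
        t = binomialTerm x y p
        first : t zero ≈ y ^ p
        first = trans (×-homo-1 _) (*-identityˡ _)
        last : t (suc (fromℕ k)) ≈ x ^ p
        last rewrite Fin.toℕ-fromℕ k | nCn≡1 (suc k) | ℕ.n∸n≡0 k = trans (×-homo-1 _) (*-identityʳ _)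
        middle : ∀ i → t (suc (inject₁ i)) ≈ 0#
        middle i = multiple≈0 (prime∣C p-prime (s≤s z≤n)
          (s≤s (≡.subst (ℕ._< k) (≡.sym (Fin.toℕ-inject₁ i)) (Fin.toℕ<n i)))) _

    frobenius^ : ∀ r x y → (x + y) ^ (p ℕ.^ r) ≈ x ^ (p ℕ.^ r) + y ^ (p ℕ.^ r)
    frobenius^ zero    x y = trans (*-identityʳ _) (+-cong (sym (*-identityʳ x)) (sym (*-identityʳ y)))
    frobenius^ (suc r) x y = begin
      (x + y) ^ (p ℕ.* p ℕ.^ r)                            ≈⟨ ^-assocʳ (x + y) p (p ℕ.^ r) ⟨
      ((x + y) ^ p) ^ (p ℕ.^ r)                            ≈⟨ ^-congˡ (p ℕ.^ r) (frobenius x y) ⟩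
      (x ^ p + y ^ p) ^ (p ℕ.^ r)                          ≈⟨ frobenius^ r (x ^ p) (y ^ p) ⟩
      (x ^ p) ^ (p ℕ.^ r) + (y ^ p) ^ (p ℕ.^ r)            ≈⟨ +-cong (^-assocʳ x p (p ℕ.^ r)) (^-assocʳ y p (p ℕ.^ r)) ⟩
      x ^ (p ℕ.* p ℕ.^ r) + y ^ (p ℕ.* p ℕ.^ r)            ∎

-- Finite fields and their cyclotomic classes

module FiniteField (F : CommutativeRing c ℓ) {Q : ℕ} (F-field : IsFieldOfOrder F Q) where

  open CommutativeRing F hiding (zero)
  open IsFieldOfOrder F-field
  open Algebra.Properties.CommutativeSemiring.Exp commutativeSemiring
  open Algebra.Properties.CommutativeMonoid.Sum +-commutativeMonoid
  open Algebra.Properties.Semiring.Mult semiring renaming (_×_ to _·_)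
  open Algebra.Properties.Ring ring
  open IntegerSolver F
  open import Relation.Binary.Reasoning.Setoid setoid

  module order = Inverse order

  from-injective : ∀ {i j} → order.from i ≈ order.from j → i ≡ j
  from-injective eq = ≡.trans (≡.sym (order.inverseˡ refl)) (order.inverseˡ eq)

  infix 4 _≟_
  _≟_ : Decidable _≈_
  x ≟ y with order.to x Fin.≟ order.to y
  ... | yes eq = yes (trans (sym (order.inverseʳ ≡.refl)) (order.inverseʳ eq))
  ... | no neq = no λ x≈y → neq (order.to-cong x≈y)

  cancel : ∀ {x y z} → ¬ x ≈ 0# → x * y ≈ x * z → y ≈ z
  cancel {x} {y} {z} x≉0 xy≈xz with x⁻¹ , xx⁻¹≈1 ← inverse x x≉0 = begin
    y              ≈⟨ *-identityˡ y ⟨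
    1# * y         ≈⟨ *-congʳ xx⁻¹≈1 ⟨
    x * x⁻¹ * y    ≈⟨ solve 3 (λ x w y → x :* w :* y := w :* (x :* y)) refl x x⁻¹ y ⟩
    x⁻¹ * (x * y)  ≈⟨ *-congˡ xy≈xz ⟩
    x⁻¹ * (x * z)  ≈⟨ solve 3 (λ x w y → x :* w :* y := w :* (x :* y)) refl x x⁻¹ z ⟨
    x * x⁻¹ * z    ≈⟨ *-congʳ xx⁻¹≈1 ⟩
    1# * z         ≈⟨ *-identityˡ z ⟩
    z              ∎

  zero-product : ∀ x y → x * y ≈ 0# → x ≈ 0# ⊎ y ≈ 0#
  zero-product x y xy≈0 with x ≟ 0#
  ... | yes x≈0 = inj₁ x≈0
  ... | no  x≉0 = inj₂ (cancel x≉0 (trans xy≈0 (sym (zeroʳ x))))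

  ^≉0 : ∀ {x} → ¬ x ≈ 0# → ∀ k → ¬ x ^ k ≈ 0#
  ^≉0 x≉0 zero    eq = 1≉0 eq
  ^≉0 x≉0 (suc k) eq with zero-product _ _ eq
  ... | inj₁ x≈0 = x≉0 x≈0
  ... | inj₂ eq′ = ^≉0 x≉0 k eq′

  ^-difference : ∀ {x k l} → ¬ x ≈ 0# → k ℕ.< l → x ^ k ≈ x ^ l → x ^ (l ℕ.∸ k) ≈ 1#
  ^-difference {x} {k} {l} x≉0 k<l eq = cancel (^≉0 x≉0 k) (begin
    x ^ k * x ^ (l ℕ.∸ k)     ≈⟨ ^-homo-* x k (l ℕ.∸ k) ⟨
    x ^ (k ℕ.+ (l ℕ.∸ k))     ≡⟨ ≡.cong (x ^_) (ℕ.m+[n∸m]≡n (ℕ.<⇒≤ k<l)) ⟩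
    x ^ l                     ≈⟨ eq ⟨
    x ^ k                     ≈⟨ *-identityʳ _ ⟨
    x ^ k * 1#                ∎)

  ^-distinct : ∀ {x m k l} → ¬ x ≈ 0# → HasMultiplicativeOrder F x m → k ℕ.< l → l ℕ.< m → ¬ x ^ k ≈ x ^ l
  ^-distinct {k = k} {l} x≉0 x-order k<l l<m eq = HasMultiplicativeOrder.minimal x-order (l ℕ.∸ k)
    (ℕ.m<n⇒0<n∸m k<l) (ℕ.≤-<-trans (ℕ.m∸n≤m l k) l<m) (^-difference x≉0 k<l eq)

  ^-injective : ∀ {x m k l} → ¬ x ≈ 0# → HasMultiplicativeOrder F x m → k ℕ.< m → l ℕ.< m → x ^ k ≈ x ^ l → k ≡ l
  ^-injective {x} {m} {k} {l} x≉0 x-order k<m l<m eq with ℕ.<-cmp k l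
  ... | tri< k<l _ _ = contradiction eq (^-distinct x≉0 x-order k<l l<m)
  ... | tri≈ _ k≡l _ = k≡l
  ... | tri> _ _ l<k = contradiction (sym eq) (^-distinct x≉0 x-order l<k k<m)

  -- The sum of all elements is invariant under translation by x.
  order·x≈0 : ∀ x → Q · x ≈ 0#
  order·x≈0 x = +-cancelʳ (sum order.from) _ _ (begin
    Q · x + sum order.from                      ≈⟨ +-congʳ (sum-replicate Q) ⟨
    sum {Q} (λ _ → x) + sum order.from          ≈⟨ ∑-distrib-+ (λ _ → x) order.from ⟨
    sum (λ i → x + order.from i)                ≈⟨ sum-cong-≋ {Q} (λ i → order.inverseʳ ≡.refl) ⟨
    sum (λ i → order.from (order.to (x + order.from i)))  ≈⟨ sum-permute order.from translation ⟨
    sum order.from                              ≈⟨ +-identityˡ _ ⟨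
    0# + sum order.from                         ∎)
    where
    translate : Carrier → Fin Q → Fin Q
    translate y i = order.to (y + order.from i)
    translate-inverse : ∀ y z → y + z ≈ 0# → ∀ i → translate y (translate z i) ≡ i
    translate-inverse y z y+z≈0 i = order.inverseˡ (begin
      y + order.from (order.to (z + order.from i))  ≈⟨ +-congˡ (order.inverseʳ ≡.refl) ⟩
      y + (z + order.from i)                        ≈⟨ +-assoc _ _ _ ⟨
      y + z + order.from i                          ≈⟨ +-congʳ y+z≈0 ⟩
      0# + order.from i                             ≈⟨ +-identityˡ _ ⟩
      order.from i                                  ∎)
    translation = mk↔ₛ′ (translate x) (translate (- x))
      (translate-inverse x (- x) (-‿inverseʳ x)) (translate-inverse (- x) x (-‿inverseˡ x))

  -- Q · 1 = 0 is a product of copies of p · 1, and a field has no zero divisors.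
  characteristic : ∀ p s → Q ≡ p ℕ.^ s → p · 1# ≈ 0#
  characteristic p s Q≡p^s = p^k·1≈0⇒p·1≈0 s (trans (×-congˡ (≡.sym Q≡p^s)) (order·x≈0 1#))
    where
    p^k·1≈0⇒p·1≈0 : ∀ k → (p ℕ.^ k) · 1# ≈ 0# → p · 1# ≈ 0#
    p^k·1≈0⇒p·1≈0 zero    eq = contradiction (trans (sym (+-identityʳ 1#)) eq) 1≉0
    p^k·1≈0⇒p·1≈0 (suc k) eq with zero-product _ _ (trans (sym (×1-homo-* p (p ℕ.^ k))) eq)
    ... | inj₁ p≈0   = p≈0
    ... | inj₂ p^k≈0 = p^k·1≈0⇒p·1≈0 k p^k≈0

  module _ {α} (α-generates : GeneratesUnits F α) where

    open GeneratesUnits α-generates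

    -- If α ^ m = 1, then 0 and the powers of α with exponents below m already exhaust the field.
    order-≤ : ∀ {m} → 0 ℕ.< m → α ^ m ≈ 1# → Q ℕ.≤ suc m
    order-≤ {m} 0<m α^m≈1 = ℕ.≮⇒≥ λ m<Q →
      let i , j , i<j , eq = pigeonhole setoid (λ _ → ⊤) cover covers m<Q order.from (λ _ → tt)
      in Fin.<-irrefl (from-injective eq) i<j
      where
      instance _ = ℕ.>-nonZero 0<m
      cover : Fin (suc m) → Carrier
      cover zero    = 0#
      cover (suc k) = α ^ toℕ k
      covers : ∀ x → ⊤ → ∃ λ k → x ≈ cover k
      covers x _ with x ≟ 0#
      ... | yes x≈0 = zero , x≈0
      ... | no  x≉0 with t , x≈α^t ← generates x x≉0 = suc (t mod m) ,
        trans x≈α^t (trans (Powers.^-% F m α^m≈1 t) (reflexive (≡.cong (α ^_) (≡.sym (Fin.toℕ-fromℕ< (m%n<n t m))))))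

    -- Among 0 and the first Q powers of α two must coincide. Together with `order-≤` the bound m <
    -- Q forces m = Q - 1.
    some-order : ∃ λ m → 0 ℕ.< m × m ℕ.< Q × α ^ m ≈ 1#
    some-order = collision (pigeonhole setoid (λ _ → ⊤) order.from (λ x _ → order.to x , sym (order.inverseʳ ≡.refl))
                              (ℕ.n<1+n Q) f (λ _ → tt))
      where
      f : Fin (suc Q) → Carrier
      f zero    = 0#
      f (suc k) = α ^ toℕ k
      collision : (∃₂ λ k l → k Fin.< l × f k ≈ f l) → ∃ λ m → 0 ℕ.< m × m ℕ.< Q × α ^ m ≈ 1#
      collision (zero  , suc l , _ , eq) = contradiction (sym eq) (^≉0 nonzero (toℕ l))
      collision (suc k , suc l , s≤s k<l , eq) =
        toℕ l ℕ.∸ toℕ k , ℕ.m<n⇒0<n∸m k<l , ℕ.≤-<-trans (ℕ.m∸n≤m (toℕ l) (toℕ k)) (Fin.toℕ<n l) , ^-difference nonzero k<l eq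

    generator-order : HasMultiplicativeOrder F α (ℕ.pred Q)
    generator-order with m , 0<m , m<Q , α^m≈1 ← some-order = record
      { ξ^n≈1   = trans (reflexive (≡.cong (α ^_) (≡.cong ℕ.pred Q≡1+m))) α^m≈1
      ; minimal = λ k 0<k k<Q-1 α^k≈1 → ℕ.<⇒≱ k<Q-1 (ℕ.pred-mono-≤ (order-≤ 0<k α^k≈1))
      }
      where
      Q≡1+m = ℕ.≤-antisym (order-≤ 0<m α^m≈1) m<Q

-- Here q = 1 + n and e = q + 1, and β generates the e-th roots of unity, so
-- x ↦ x ^ n maps the i-th class to the single value β ^ i.

module CyclotomicClasses (F : CommutativeRing c ℓ) {n : ℕ} .{{_ : ℕ.NonZero n}}
  (F-field : IsFieldOfOrder F (suc n ℕ.* suc n)) {α} (α-generates : GeneratesUnits F α) where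

  open CommutativeRing F hiding (zero)
  open FiniteField F F-field
  open GeneratesUnits α-generates
  open Algebra.Properties.CommutativeSemiring.Exp commutativeSemiring
  open Algebra.Properties.Ring ring
  open import Relation.Binary.Reasoning.Setoid setoid

  e : ℕ
  e = suc (suc n)

  class : Fin e → Pred Carrier ℓ
  class = cyclotomicClass F α e

  -- This is q² - 1 = (q - 1)(q + 1); the left side is what the predecessor of `suc n * suc n`
  -- computes to.
  N≡n*e : n ℕ.+ n ℕ.* suc n ≡ n ℕ.* e
  N≡n*e = ≡.sym (ℕ.*-suc n (suc n))

  β : Carrier
  β = α ^ n

  α-order : HasMultiplicativeOrder F α (n ℕ.* e)
  α-order = ≡.subst (HasMultiplicativeOrder F α) N≡n*e (generator-order α-generates)

  β-order : HasMultiplicativeOrder F β e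
  β-order = record
    { ξ^n≈1   = trans (^-assocʳ α n e) ξ^n≈1
    ; minimal = λ m 0<m m<e β^m≈1 → minimal (n ℕ.* m)
        (≡.subst (ℕ._< n ℕ.* m) (ℕ.*-zeroʳ n) (ℕ.*-monoʳ-< n 0<m)) (ℕ.*-monoʳ-< n m<e) (trans (sym (^-assocʳ α n m)) β^m≈1)
    }
    where open HasMultiplicativeOrder α-order

  α^tn≈β^t : ∀ t → (α ^ t) ^ n ≈ β ^ t
  α^tn≈β^t t = trans (^-assocʳ α t n) (trans (reflexive (≡.cong (α ^_) (ℕ.*-comm t n))) (sym (^-assocʳ α n t)))

  class⇒power : ∀ {i x} → class i x → x ^ n ≈ β ^ toℕ i
  class⇒power {i} {x} (t , t%e≡i , x≈α^t) = begin
    x ^ n            ≈⟨ ^-congˡ n x≈α^t ⟩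
    (α ^ t) ^ n      ≈⟨ α^tn≈β^t t ⟩
    β ^ t            ≈⟨ Powers.^-% F e (HasMultiplicativeOrder.ξ^n≈1 β-order) t ⟩
    β ^ (t % e)      ≡⟨ ≡.cong (β ^_) t%e≡i ⟩
    β ^ toℕ i        ∎

  class-nonzero : ∀ {i x} → class i x → ¬ x ≈ 0#
  class-nonzero (t , _ , x≈α^t) x≈0 = ^≉0 nonzero t (trans (sym x≈α^t) x≈0)

  power⇒class : ∀ {i x} → ¬ x ≈ 0# → x ^ n ≈ β ^ toℕ i → class i x
  power⇒class {i} {x} x≉0 x^n≈β^i with t , x≈α^t ← generates x x≉0 =
    t , ^-injective (^≉0 nonzero n) β-order (m%n<n t e) (Fin.toℕ<n i) (begin
      β ^ (t % e)    ≈⟨ Powers.^-% F e (HasMultiplicativeOrder.ξ^n≈1 β-order) t ⟨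
      β ^ t          ≈⟨ α^tn≈β^t t ⟨
      (α ^ t) ^ n    ≈⟨ ^-congˡ n x≈α^t ⟨
      x ^ n          ≈⟨ x^n≈β^i ⟩
      β ^ toℕ i      ∎) , x≈α^t

  class-cover : ∀ x → ¬ x ≈ 0# → ∃ λ i → class i x
  class-cover x x≉0 with t , x≈α^t ← generates x x≉0 =
    t mod e , t , ≡.sym (Fin.toℕ-fromℕ< (m%n<n t e)) , x≈α^t

  class-disjoint : ∀ {i j x} → class i x → class j x → i ≡ j
  class-disjoint {i} {j} x∈i x∈j = Fin.toℕ-injective
    (^-injective (^≉0 nonzero n) β-order (Fin.toℕ<n i) (Fin.toℕ<n j) (trans (sym (class⇒power x∈i)) (class⇒power x∈j)))

  module _ (additive : ∀ x y → (x + y) ^ suc n ≈ x ^ suc n + y ^ suc n) where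

    private
      -- Multiplying x ^ n = β ^ i by x lets 0 in and makes both sides additive in x, so the
      -- solutions are closed under subtraction.
      class₀⇒linear : ∀ {i x} → class i x ⊎ x ≈ 0# → x ^ suc n ≈ x * β ^ toℕ i
      class₀⇒linear (inj₁ x∈) = *-congˡ (class⇒power x∈)
      class₀⇒linear (inj₂ x≈0) = trans (*-congʳ x≈0) (trans (zeroˡ _) (sym (trans (*-congʳ x≈0) (zeroˡ _))))

      linear⇒class₀ : ∀ {i x} → x ^ suc n ≈ x * β ^ toℕ i → class i x ⊎ x ≈ 0#
      linear⇒class₀ {x = x} eq with x ≟ 0#
      ... | yes x≈0 = inj₂ x≈0
      ... | no  x≉0 = inj₁ (power⇒class x≉0 (cancel x≉0 eq))

      -- Deducing this from additivity treats odd and even q alike.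
      negation : ∀ y → (- y) ^ suc n ≈ - (y ^ suc n)
      negation y = +-inverseʳ-unique _ _ (begin
        y ^ suc n + (- y) ^ suc n    ≈⟨ additive y (- y) ⟨
        (y - y) ^ suc n              ≈⟨ ^-congˡ (suc n) (-‿inverseʳ y) ⟩
        0# ^ suc n                   ≈⟨ zeroˡ _ ⟩
        0#                           ∎)

      class₀-closed- : ∀ {i x y} → class i x ⊎ x ≈ 0# → class i y ⊎ y ≈ 0# → class i (x - y) ⊎ x - y ≈ 0#
      class₀-closed- {i} {x} {y} x∈ y∈ = linear⇒class₀ (begin
        (x - y) ^ suc n                     ≈⟨ additive x (- y) ⟩
        x ^ suc n + (- y) ^ suc n           ≈⟨ +-cong (class₀⇒linear x∈) (trans (negation y) (-‿cong (class₀⇒linear y∈))) ⟩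
        x * β ^ toℕ i - y * β ^ toℕ i       ≈⟨ [y-z]x≈yx-zx _ x y ⟨
        (x - y) * β ^ toℕ i                 ∎)

      -- The n exponents below n e that are congruent to i modulo e. As α has order n e, their
      -- powers are distinct.
      exponent : Fin e → Fin n → ℕ
      exponent i k = toℕ i ℕ.+ toℕ k ℕ.* e

      exponent< : ∀ i k → exponent i k ℕ.< n ℕ.* e
      exponent< i k = ℕ.<-≤-trans (ℕ.+-monoˡ-< (toℕ k ℕ.* e) (Fin.toℕ<n i)) (ℕ.*-monoˡ-≤ e (Fin.toℕ<n k))

    cyclotomic-spread : Spread F class n
    cyclotomic-spread = record
      { _≟_       = _≟_
      ; resp      = λ { x≈y (t , t%e , x≈) → t , t%e , trans (sym x≈y) x≈ }
      ; nonzero   = class-nonzero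
      ; closed-   = class₀-closed-
      ; cover     = class-cover
      ; disjoint  = class-disjoint
      ; points    = λ i k → α ^ exponent i k
      ; points-∈  = λ i k → exponent i k ,
          ≡.trans ([m+kn]%n≡m%n (toℕ i) (toℕ k) e) (m<n⇒m%n≡m (Fin.toℕ<n i)) , refl
      ; points-injective = λ i {k} {l} eq → Fin.toℕ-injective (ℕ.*-cancelʳ-≡ (toℕ k) (toℕ l) e
          (ℕ.+-cancelˡ-≡ (toℕ i) _ _ (^-injective nonzero α-order (exponent< i k) (exponent< i l) eq)))
      }

-- Designs in which every pair of points is exactly one block

record PairDesign (𝒟 : Design p p′ b b′ i) : Set (p ⊔ p′ ⊔ b ⊔ b′ ⊔ i) where
  open Design 𝒟
  open Setoid Point renaming (Carrier to P; _≈_ to _≈ₚ_) using () public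
  open Setoid Block renaming (Carrier to B; _≈_ to _≈ᵇ_) using () public
  field
    end₁ end₂ : B → P
    distinct  : ∀ X → ¬ end₁ X ≈ₚ end₂ X
    end₁-∈    : ∀ X → end₁ X ∈ᵇ X
    end₂-∈    : ∀ X → end₂ X ∈ᵇ X
    ends      : ∀ {x X} → x ∈ᵇ X → x ≈ₚ end₁ X ⊎ x ≈ₚ end₂ X
    join      : ∀ {x y} → ¬ x ≈ₚ y → ∃ λ X → x ∈ᵇ X × y ∈ᵇ X
    unique    : ∀ {x y X Y} → ¬ x ≈ₚ y → x ∈ᵇ X → y ∈ᵇ X → x ∈ᵇ Y → y ∈ᵇ Y → X ≈ᵇ Y

  ends-of : ∀ {x y z X} → ¬ x ≈ₚ y → x ∈ᵇ X → y ∈ᵇ X → z ∈ᵇ X → z ≈ₚ x ⊎ z ≈ₚ y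
  ends-of x≉y x∈X y∈X z∈X with ends x∈X | ends y∈X | ends z∈X
  ... | inj₁ x≈ | inj₁ y≈ | _       = contradiction (Setoid.trans Point x≈ (Setoid.sym Point y≈)) x≉y
  ... | inj₁ x≈ | inj₂ y≈ | inj₁ z≈ = inj₁ (Setoid.trans Point z≈ (Setoid.sym Point x≈))
  ... | inj₁ x≈ | inj₂ y≈ | inj₂ z≈ = inj₂ (Setoid.trans Point z≈ (Setoid.sym Point y≈))
  ... | inj₂ x≈ | inj₁ y≈ | inj₁ z≈ = inj₂ (Setoid.trans Point z≈ (Setoid.sym Point y≈))
  ... | inj₂ x≈ | inj₁ y≈ | inj₂ z≈ = inj₁ (Setoid.trans Point z≈ (Setoid.sym Point x≈))
  ... | inj₂ x≈ | inj₂ y≈ | _       = contradiction (Setoid.trans Point x≈ (Setoid.sym Point y≈)) x≉y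

private
  module BlockMap {𝒟 : Design p p′ b b′ i} {ℰ : Design q q′ ε ε′ j}
    (φ : Inverse (Design.Point 𝒟) (Design.Point ℰ)) (𝓟 : PairDesign 𝒟) (𝓠 : PairDesign ℰ) where

    module 𝒟 = Design 𝒟
    module ℰ = Design ℰ
    module P𝒟 = Setoid 𝒟.Point
    module Pℰ = Setoid ℰ.Point
    module 𝓟 = PairDesign 𝓟
    module 𝓠 = PairDesign 𝓠
    module φ = Inverse φ

    φ≉ : ∀ {x y} → ¬ x P𝒟.≈ y → ¬ φ.to x Pℰ.≈ φ.to y
    φ≉ x≉y eq = x≉y (P𝒟.trans (P𝒟.sym (φ.inverseʳ Pℰ.refl)) (φ.inverseʳ eq))

    blockMap : 𝓟.B → 𝓠.B
    blockMap X = proj₁ (𝓠.join (φ≉ (𝓟.distinct X)))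

    end₁-image : ∀ X → φ.to (𝓟.end₁ X) ℰ.∈ᵇ blockMap X
    end₁-image X = proj₁ (proj₂ (𝓠.join (φ≉ (𝓟.distinct X))))

    end₂-image : ∀ X → φ.to (𝓟.end₂ X) ℰ.∈ᵇ blockMap X
    end₂-image X = proj₂ (proj₂ (𝓠.join (φ≉ (𝓟.distinct X))))

    image-∈ : ∀ {x X} → x 𝒟.∈ᵇ X → φ.to x ℰ.∈ᵇ blockMap X
    image-∈ {X = X} x∈X with 𝓟.ends x∈X
    ... | inj₁ x≈ = ℰ.∈ᵇ-resp (φ.to-cong (P𝒟.sym x≈)) (Setoid.refl ℰ.Block) (end₁-image X)
    ... | inj₂ x≈ = ℰ.∈ᵇ-resp (φ.to-cong (P𝒟.sym x≈)) (Setoid.refl ℰ.Block) (end₂-image X)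

    ∈-image : ∀ {x X} → φ.to x ℰ.∈ᵇ blockMap X → x 𝒟.∈ᵇ X
    ∈-image {x} {X} φx∈ with 𝓠.ends-of (φ≉ (𝓟.distinct X)) (end₁-image X) (end₂-image X) φx∈
    ... | inj₁ eq = 𝒟.∈ᵇ-resp (P𝒟.trans (P𝒟.sym (φ.inverseʳ Pℰ.refl)) (φ.inverseʳ (Pℰ.sym eq))) (Setoid.refl 𝒟.Block) (𝓟.end₁-∈ X)
    ... | inj₂ eq = 𝒟.∈ᵇ-resp (P𝒟.trans (P𝒟.sym (φ.inverseʳ Pℰ.refl)) (φ.inverseʳ (Pℰ.sym eq))) (Setoid.refl 𝒟.Block) (𝓟.end₂-∈ X)

    blockMap-cong : ∀ {X Y} → X 𝓟.≈ᵇ Y → blockMap X 𝓠.≈ᵇ blockMap Y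
    blockMap-cong {X} X≈Y = 𝓠.unique (φ≉ (𝓟.distinct X)) (end₁-image X) (end₂-image X)
      (image-∈ (𝒟.∈ᵇ-resp P𝒟.refl X≈Y (𝓟.end₁-∈ X))) (image-∈ (𝒟.∈ᵇ-resp P𝒟.refl X≈Y (𝓟.end₂-∈ X)))

  module BlockMapInverse {𝒟 : Design p p′ b b′ i} {ℰ : Design q q′ ε ε′ j}
    (φ : Inverse (Design.Point 𝒟) (Design.Point ℰ)) (𝓟 : PairDesign 𝒟) (𝓠 : PairDesign ℰ) where

    open BlockMap φ 𝓟 𝓠
    module Back = BlockMap (Symmetry.inverse φ) 𝓠 𝓟

    blockMap-inverse : ∀ {X Y} → X 𝓟.≈ᵇ Back.blockMap Y → blockMap X 𝓠.≈ᵇ Y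
    blockMap-inverse {X} {Y} X≈ = 𝓠.unique (𝓠.distinct Y) (in-image (𝓠.end₁-∈ Y)) (in-image (𝓠.end₂-∈ Y))
      (𝓠.end₁-∈ Y) (𝓠.end₂-∈ Y)
      where
      in-image : ∀ {y} → y ℰ.∈ᵇ Y → y ℰ.∈ᵇ blockMap X
      in-image y∈Y = ℰ.∈ᵇ-resp (φ.inverseˡ P𝒟.refl) (Setoid.refl ℰ.Block)
        (image-∈ (𝒟.∈ᵇ-resp P𝒟.refl (Setoid.sym 𝒟.Block X≈) (Back.image-∈ y∈Y)))

-- Any bijection of the points extends to the blocks: a block goes to the unique block joining the
-- images of its two ends.
pairDesigns-≅ : {𝒟 : Design p p′ b b′ i} {ℰ : Design q q′ ε ε′ j} →
                Inverse (Design.Point 𝒟) (Design.Point ℰ) → PairDesign 𝒟 → PairDesign ℰ → 𝒟 ≅ ℰ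
pairDesigns-≅ φ 𝓟 𝓠 = record
  { points = φ
  ; blocks = record
    { to        = blockMap
    ; from      = Back.blockMap
    ; to-cong   = blockMap-cong
    ; from-cong = Back.blockMap-cong
    -- The second half is the first with the two designs exchanged; inverting `φ` twice gives back
    -- `φ` by computation.
    ; inverse   = blockMap-inverse , BlockMapInverse.blockMap-inverse (Symmetry.inverse φ) 𝓠 𝓟
    }
  ; image = λ x X → mk⇔ image-∈ ∈-image
  }
  where
  open BlockMap φ 𝓟 𝓠
  open BlockMapInverse φ 𝓟 𝓠

record SignPartition (R : CommutativeRing c ℓ) {I : Set a} (D : I → Pred (CommutativeRing.Carrier R) δ) :
                     Set (c ⊔ ℓ ⊔ a ⊔ δ) where
  open CommutativeRing R
  field
    half     : Carrier
    2*half≈1 : (1# + 1#) * half ≈ 1#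
    rep      : I → Carrier
    rep≉0    : ∀ i → ¬ rep i ≈ 0#
    D⇒±      : ∀ {i x} → D i x → x ≈ rep i ⊎ x ≈ - rep i
    ±⇒D      : ∀ {i x} → x ≈ rep i ⊎ x ≈ - rep i → D i x
    cover    : ∀ x → ¬ x ≈ 0# → ∃ λ i → D i x
    disjoint : ∀ {i j x} → D i x → D j x → i ≡ j

module _ {R : CommutativeRing c ℓ} {I : Set a} {D : I → Pred (CommutativeRing.Carrier R) δ}
         (𝓢 : SignPartition R D) where

  open CommutativeRing R hiding (zero)
  open SignPartition 𝓢
  open IntegerSolver R
  open Algebra.Properties.Ring ring
  open import Relation.Binary.Reasoning.Setoid setoid

  private
    halve : ∀ x → half * (x + x) ≈ x
    halve x = begin
      half * (x + x)             ≈⟨ solve 2 (λ h x → h :* (x :+ x) := (con (+ 1) :+ con (+ 1)) :* h :* x) refl half x ⟩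
      (1# + 1#) * half * x       ≈⟨ *-congʳ 2*half≈1 ⟩
      1# * x                     ≈⟨ *-identityˡ x ⟩
      x                          ∎

    rep≉-rep : ∀ i → ¬ rep i ≈ - rep i
    rep≉-rep i eq = rep≉0 i (begin
      rep i                        ≈⟨ halve (rep i) ⟨
      half * (rep i + rep i)       ≈⟨ *-congˡ (+-congʳ eq) ⟩
      half * (- rep i + rep i)     ≈⟨ *-congˡ (-‿inverseˡ _) ⟩
      half * 0#                    ≈⟨ zeroʳ half ⟩
      0#                           ∎)

    midpoint : ∀ x y → half * (x - y) + half * (x + y) ≈ x
    midpoint x y = trans
      (solve 3 (λ h x y → h :* (x :- y) :+ h :* (x :+ y) := h :* (x :+ x)) refl half x y) (halve x)

    negate : ∀ {i x} → D i x → D i (- x)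
    negate x∈D with D⇒± x∈D
    ... | inj₁ x≈ = ±⇒D (inj₂ (-‿cong x≈))
    ... | inj₂ x≈ = ±⇒D (inj₁ (trans (-‿cong x≈) (-‿involutive _)))

    opposite : ∀ {i x y} → ¬ x ≈ y → D i x → D i y → y ≈ - x
    opposite x≉y x∈D y∈D with D⇒± x∈D | D⇒± y∈D
    ... | inj₁ x≈ | inj₁ y≈ = contradiction (trans x≈ (sym y≈)) x≉y
    ... | inj₁ x≈ | inj₂ y≈ = trans y≈ (-‿cong (sym x≈))
    ... | inj₂ x≈ | inj₁ y≈ = trans y≈ (trans (sym (-‿involutive _)) (-‿cong (sym x≈)))
    ... | inj₂ x≈ | inj₂ y≈ = contradiction (trans x≈ (sym y≈)) x≉y

    resp : ∀ {i x y} → x ≈ y → D i x → D i y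
    resp x≈y x∈D = ±⇒D (Sum.map (trans (sym x≈y)) (trans (sym x≈y)) (D⇒± x∈D))

    -- The block is {u + g, - u + g}, so g is the midpoint of x and y, and u is half their
    -- difference. Hence x and y determine the block.
    block : ∀ {x y i g u v} → ¬ x ≈ y → D i u → x ≈ u + g → D i v → y ≈ v + g →
            D i (half * (x - y)) × g ≈ half * (x + y)
    block {x} {y} {i} {g} {u} {v} x≉y u∈D x≈ v∈D y≈ = resp u≈ u∈D , g≈
      where
      v≈-u : v ≈ - u
      v≈-u = opposite (λ u≈v → x≉y (trans x≈ (trans (+-congʳ u≈v) (sym y≈)))) u∈D v∈D
      y≈-u+g : y ≈ - u + g
      y≈-u+g = trans y≈ (+-congʳ v≈-u)
      u≈ : u ≈ half * (x - y)
      u≈ = sym (begin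
        half * (x - y)                 ≈⟨ *-congˡ (+-cong x≈ (-‿cong y≈-u+g)) ⟩
        half * (u + g - (- u + g))     ≈⟨ *-congˡ (solve 2 (λ u g → u :+ g :- (:- u :+ g) := u :+ u) refl u g) ⟩
        half * (u + u)                 ≈⟨ halve u ⟩
        u                              ∎)
      g≈ : g ≈ half * (x + y)
      g≈ = sym (begin
        half * (x + y)                 ≈⟨ *-congˡ (+-cong x≈ y≈-u+g) ⟩
        half * (u + g + (- u + g))     ≈⟨ *-congˡ (solve 2 (λ u g → u :+ g :+ (:- u :+ g) := g :+ g) refl u g) ⟩
        half * (g + g)                 ≈⟨ halve g ⟩
        g                              ∎)

  signPartition-pairDesign : PairDesign (dev +-abelianGroup D)
  signPartition-pairDesign = record
    { end₁     = λ (i , g) → rep i + g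
    ; end₂     = λ (i , g) → - rep i + g
    ; distinct = λ (i , g) eq → rep≉-rep i (+-cancelʳ g _ _ eq)
    ; end₁-∈   = λ (i , g) → rep i , ±⇒D (inj₁ refl) , refl
    ; end₂-∈   = λ (i , g) → - rep i , ±⇒D (inj₂ refl) , refl
    ; ends     = λ (y , y∈D , x≈) → Sum.map (λ y≈ → trans x≈ (+-congʳ y≈)) (λ y≈ → trans x≈ (+-congʳ y≈)) (D⇒± y∈D)
    ; join     = λ {x} {y} x≉y →
        let i , u∈D = cover (half * (x - y)) λ eq → x≉y (x∙y⁻¹≈ε⇒x≈y x y (begin
                        x - y                              ≈⟨ halve (x - y) ⟨
                        half * ((x - y) + (x - y))         ≈⟨ distribˡ _ _ _ ⟩
                        half * (x - y) + half * (x - y)    ≈⟨ +-cong eq eq ⟩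
                        0# + 0#                            ≈⟨ +-identityˡ 0# ⟩
                        0#                                 ∎))
        in (i , half * (x + y)) ,
           (half * (x - y) , u∈D , sym (midpoint x y)) ,
           (- (half * (x - y)) , negate u∈D , sym (trans
             (solve 3 (λ h x y → :- (h :* (x :- y)) :+ h :* (x :+ y) := h :* (y :- x) :+ h :* (y :+ x)) refl half x y)
             (midpoint y x)))
    ; unique   = λ x≉y (_ , u∈ , x≈) (_ , v∈ , y≈) (_ , u∈′ , x≈′) (_ , v∈′ , y≈′) →
        let i∋ , g≈ = block x≉y u∈ x≈ v∈ y≈
            j∋ , h≈ = block x≉y u∈′ x≈′ v∈′ y≈′
        in disjoint i∋ j∋ , trans g≈ (sym h≈)
    }

-- Integers modulo n, and quotients by a monic linear polynomial

module Residues (n : ℕ) .{{_ : ℕ.NonZero n}} where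

  open CommutativeRing (ℤ/ n) using (_≈_; sym; trans)
  open Quotient ℤ.+-*-commutativeRing (+ n) using (mk≈/)
  open RawMagma (CommutativeRing.*-rawMagma ℤ.+-*-commutativeRing) using (_,_)

  residue : ℤ → Fin n
  residue z = fromℕ< (ℤ.n%ℕd<d z n)

  residue≈ : ∀ z → + toℕ (residue z) ≈ z
  residue≈ z = sym (mk≈/ (z /ℕ n , ≡.sym (begin
    z ℤ.- + toℕ (residue z)                    ≡⟨ ≡.cong (λ r → z ℤ.- + r) (Fin.toℕ-fromℕ< (ℤ.n%ℕd<d z n)) ⟩
    z ℤ.- r                                    ≡⟨ ≡.cong (ℤ._- r) (ℤ.a≡a%ℕn+[a/ℕn]*n z n) ⟩
    r ℤ.+ (z /ℕ n) ℤ.* + n ℤ.- r               ≡⟨ xyx⁻¹≈y r _ ⟩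
    (z /ℕ n) ℤ.* + n                           ∎)))
    where
    open ≡.≡-Reasoning
    open Algebra.Properties.Ring ℤ.+-*-ring using (xyx⁻¹≈y)
    r = + (z %ℕ n)

  -- A multiple of n with absolute value less than n is 0.
  toℕ-injective-mod : ∀ {k l : Fin n} → + toℕ k ≈ + toℕ l → k ≡ l
  toℕ-injective-mod {k} {l} (mk≈/ (t , t*n≡k-l)) =
    Fin.toℕ-injective (ℤ.+-injective (ℤ.i-j≡0⇒i≡j _ _ (ℤ.∣i∣≡0⇒i≡0 ∣k-l∣≡0)))
    where
    ∣t∣*n≡∣k-l∣ : ℤ.∣ t ∣ ℕ.* n ≡ ℤ.∣ + toℕ k ℤ.- + toℕ l ∣
    ∣t∣*n≡∣k-l∣ = ≡.trans (≡.sym (ℤ.abs-* t (+ n))) (≡.cong ℤ.∣_∣ t*n≡k-l)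
    ∣k-l∣<n : ℤ.∣ + toℕ k ℤ.- + toℕ l ∣ ℕ.< n
    ∣k-l∣<n rewrite ℤ.m-n≡m⊖n (toℕ k) (toℕ l) =
      ℕ.≤-<-trans (ℤ.∣m⊝n∣≤m⊔n (toℕ k) (toℕ l)) (ℕ.⊔-pres-<m (Fin.toℕ<n k) (Fin.toℕ<n l))
    ∣k-l∣≡0 : ℤ.∣ + toℕ k ℤ.- + toℕ l ∣ ≡ 0
    ∣k-l∣≡0 with ℤ.∣ t ∣ | ∣t∣*n≡∣k-l∣
    ... | zero  | eq = ≡.sym eq
    ... | suc s | eq = contradiction (≡.subst (ℕ._< n) (≡.sym eq) ∣k-l∣<n) (ℕ.≤⇒≯ (ℕ.m≤m+n n (s ℕ.* n)))

  residue-cong : ∀ {x y} → x ≈ y → residue x ≡ residue y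
  residue-cong {x} {y} x≈y = toℕ-injective-mod (trans (residue≈ x) (trans x≈y (sym (residue≈ y))))

  residue-toℕ : ∀ k → residue (+ toℕ k) ≡ k
  residue-toℕ k = toℕ-injective-mod (residue≈ (+ toℕ k))

module LinearQuotient (A : CommutativeRing c ℓ) (f : Poly A) (f-monic : Monic A 1 f) where

  private
    module A = CommutativeRing A
  open Polynomial A hiding (Poly; coeff; Monic; polynomialRing)
  open A using (Carrier; _≈_; _+_; _-_; -_; 0#; 1#) renaming (_*_ to _·_)
  open Algebra.Properties.Ring A.ring
  open IntegerSolver A
  open Polynomial.Monic f-monic

  root : Carrier
  root = - coeff A f 0

  eval : Poly A → Carrier
  eval []      = 0#
  eval (a ∷ g) = a + root · eval g

  eval-≈0 : ∀ g → g ≈ₚ [] → eval g ≈ 0#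
  eval-≈0 []      _         = A.refl
  eval-≈0 (a ∷ g) (mk≈ₚ eq) = A.trans (A.+-cong (eq 0) (A.trans (A.*-congˡ (eval-≈0 g (mk≈ₚ λ n → eq (suc n)))) (A.zeroʳ root))) (A.+-identityˡ 0#)

  eval-cong : ∀ g h → g ≈ₚ h → eval g ≈ eval h
  eval-cong []      h       eq         = A.sym (eval-≈0 h (symₚ eq))
  eval-cong (a ∷ g) []      eq         = eval-≈0 (a ∷ g) eq
  eval-cong (a ∷ g) (b ∷ h) (mk≈ₚ eq) = A.+-cong (eq 0) (A.*-congˡ (eval-cong g h (mk≈ₚ λ n → eq (suc n))))

  eval-+ : ∀ g h → eval (g +ₚ h) ≈ eval g + eval h
  eval-+ []      h       = A.sym (A.+-identityˡ _)
  eval-+ (a ∷ g) []      = A.sym (A.+-identityʳ _)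
  eval-+ (a ∷ g) (b ∷ h) = A.trans (A.+-congˡ (A.*-congˡ (eval-+ g h)))
    (solve 5 (λ a b r x y → (a :+ b) :+ r :* (x :+ y) := (a :+ r :* x) :+ (b :+ r :* y)) A.refl a b root (eval g) (eval h))

  eval-neg : ∀ g → eval (-ₚ g) ≈ - eval g
  eval-neg []      = A.sym -0#≈0#
  eval-neg (a ∷ g) = A.trans (A.+-congˡ (A.*-congˡ (eval-neg g)))
    (solve 3 (λ a r x → :- a :+ r :* (:- x) := :- (a :+ r :* x)) A.refl a root (eval g))

  eval-· : ∀ a g → eval (a ·ₚ g) ≈ a · eval g
  eval-· a []      = A.sym (A.zeroʳ a)
  eval-· a (b ∷ g) = A.trans (A.+-congˡ (A.*-congˡ (eval-· a g)))
    (solve 4 (λ a b r x → a :* b :+ r :* (a :* x) := a :* (b :+ r :* x)) A.refl a b root (eval g))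

  eval-* : ∀ g h → eval (g *ₚ h) ≈ eval g · eval h
  eval-* []      h = A.sym (A.zeroˡ _)
  eval-* (a ∷ g) h = A.trans (eval-+ (a ·ₚ h) (0# ∷ (g *ₚ h)))
    (A.trans (A.+-cong (eval-· a h) (A.+-congˡ (A.*-congˡ (eval-* g h))))
      (solve 4 (λ a r x y → a :* y :+ (con (+ 0) :+ r :* (x :* y)) := (a :+ r :* x) :* y) A.refl a root (eval g) (eval h)))

  X-root : Poly A
  X-root = - root ∷ 1# ∷ []

  f≈X-root : f ≈ₚ X-root
  f≈X-root = mk≈ₚ λ
    { 0             → A.sym (-‿involutive _)
    ; 1             → leading-coeff
    ; (suc (suc n)) → higher-coeffs (suc (suc n)) (s≤s (s≤s z≤n)) }

  eval-f≈0 : eval f ≈ 0#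
  eval-f≈0 = A.trans (eval-cong f X-root f≈X-root)
    (solve 1 (λ r → :- r :+ r :* (con (+ 1) :+ r :* con (+ 0)) := con (+ 0)) A.refl root)

  factor⇒eval≈ : ∀ k {g h} → k *ₚ f ≈ₚ g +ₚ (-ₚ h) → eval g ≈ eval h
  factor⇒eval≈ k {g} {h} kf≈g-h = x∙y⁻¹≈ε⇒x≈y _ _ (begin
    eval g - eval h        ≈⟨ A.+-congˡ (eval-neg h) ⟨
    eval g + eval (-ₚ h)   ≈⟨ eval-+ g (-ₚ h) ⟨
    eval (g +ₚ (-ₚ h))     ≈⟨ eval-cong (k *ₚ f) (g +ₚ (-ₚ h)) kf≈g-h ⟨
    eval (k *ₚ f)          ≈⟨ eval-* k f ⟩
    eval k · eval f        ≈⟨ A.trans (A.*-congˡ eval-f≈0) (A.zeroʳ _) ⟩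
    0#                     ∎)
    where open import Relation.Binary.Reasoning.Setoid A.setoid

  constant : Carrier → Poly A
  constant a = a ∷ []

  eval-constant : ∀ a → eval (constant a) ≈ a
  eval-constant a = A.trans (A.+-congˡ (A.zeroʳ root)) (A.+-identityʳ a)

  -- Synthetic division by X - `root`. What is divided is `eval g` - g rather than its negative, so
  -- that `remainder` shows the constant `eval g` to be congruent to g.
  quotient : Poly A → Poly A
  quotient []      = []
  quotient (a ∷ g) = - eval g ∷ quotient g

  remainder : ∀ g → quotient g *ₚ f ≈ₚ constant (eval g) +ₚ (-ₚ g)
  remainder []      = symₚ 0∷[]≈[]
  remainder (a ∷ g) = begin
    (- r ·ₚ f) +ₚ (0# ∷ (quotient g *ₚ f))                    ≈⟨ +-congₚ (·-cong A.refl f≈X-root) (∷-cong A.refl (remainder g)) ⟩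
    (- r ·ₚ X-root) +ₚ (0# ∷ (constant r +ₚ (-ₚ g)))          ≈⟨ ∷-cong
      (solve 3 (λ r x a → :- r :* (:- x) :+ con (+ 0) := (a :+ x :* r) :- a) A.refl r root a)
      (transₚ (symₚ (+-assocₚ (constant (- r · 1#)) (constant r) (-ₚ g)))
        (+-congₚ (transₚ (∷-cong (solve 1 (λ r → :- r :* con (+ 1) :+ r := con (+ 0)) A.refl r) reflₚ) 0∷[]≈[]) reflₚ)) ⟩
    constant (a + root · r) +ₚ (-ₚ (a ∷ g))                   ∎
    where
    r = eval g
    open import Relation.Binary.Reasoning.Setoid (CommutativeRing.setoid (A [X]))

-- The two families on nine points as sets {x, - x}

module FieldOfOrderNine (F : CommutativeRing c ℓ) (F-field : IsFieldOfOrder F 9)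
  {α} (α-generates : GeneratesUnits F α) where

  open CommutativeRing F hiding (zero)
  open FiniteField F {9} F-field
  open CyclotomicClasses F {2} F-field α-generates
  open GeneratesUnits α-generates
  open Algebra.Properties.CommutativeSemiring.Exp commutativeSemiring
  open Algebra.Properties.Ring ring
  open IntegerSolver F
  open import Relation.Binary.Reasoning.Setoid setoid

  square-rep : ∀ (i : Fin e) → (α ^ toℕ i) ^ 2 ≈ β ^ toℕ i
  square-rep i = α^tn≈β^t (toℕ i)

  sign : ∀ x y → x ^ 2 ≈ y ^ 2 → x ≈ y ⊎ x ≈ - y
  sign x y x²≈y² = Sum.map (x∙y⁻¹≈ε⇒x≈y x y) (+-inverseˡ-unique x y) (zero-product (x - y) (x + y) (begin
    (x - y) * (x + y)                ≈⟨ solve 2 (λ x y → (x :- y) :* (x :+ y) := x :* (x :* con (+ 1)) :- y :* (y :* con (+ 1))) refl x y ⟩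
    x ^ 2 - y ^ 2                    ≈⟨ x≈y⇒x∙y⁻¹≈ε x²≈y² ⟩
    0#                               ∎))

  -- Here n = 2, so a class consists of the elements with a given square.
  field-signPartition : SignPartition F class
  field-signPartition = record
    -- In characteristic 3 the element 2 is its own inverse.
    { half     = 1# + 1#
    ; 2*half≈1 = begin
        (1# + 1#) * (1# + 1#)           ≈⟨ solve 0 ((con (+ 1) :+ con (+ 1)) :* (con (+ 1) :+ con (+ 1)) := (con (+ 1) :+ (con (+ 1) :+ (con (+ 1) :+ con (+ 0)))) :+ con (+ 1)) refl ⟩
        (1# + (1# + (1# + 0#))) + 1#    ≈⟨ +-congʳ (characteristic 3 2 ≡.refl) ⟩
        0# + 1#                         ≈⟨ +-identityˡ 1# ⟩
        1#                              ∎
    ; rep      = λ i → α ^ toℕ i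
    ; rep≉0    = λ i → ^≉0 nonzero (toℕ i)
    ; D⇒±      = λ {i} {x} x∈ → sign x (α ^ toℕ i) (trans (class⇒power x∈) (sym (square-rep i)))
    ; ±⇒D      = λ {i} → Sum.[
        (λ x≈ → power⇒class (λ x≈0 → ^≉0 nonzero (toℕ i) (trans (sym x≈) x≈0)) (trans (^-congˡ 2 x≈) (square-rep i))) ,
        (λ x≈ → power⇒class (λ x≈0 → ^≉0 nonzero (toℕ i) (-‿injective (trans (sym x≈) (trans x≈0 (sym -0#≈0#)))))
          (trans (^-congˡ 2 x≈) (trans (solve 1 (λ x → :- x :* (:- x :* con (+ 1)) := x :* (x :* con (+ 1))) refl (α ^ toℕ i)) (square-rep i)))) ]
    ; cover    = class-cover
    ; disjoint = class-disjoint
    }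

module _ (R : CommutativeRing c ℓ) where

  open CommutativeRing R
  open Algebra.Properties.Semiring.Mult semiring renaming (_×_ to _·_)

  module CyclicRingOfOrderNine
    (code : Inverse setoid (≡.setoid (Fin 9))) (code-· : ∀ k → Inverse.to code (k · 1#) ≡ k mod 9)
    (ξ : Carrier) (ξ-order : HasMultiplicativeOrder R ξ 2) where

    open HasMultiplicativeOrder ξ-order
    open TeichmüllerFamily R 3 ξ ξ-order (s≤s (s≤s z≤n)) using (scale; family⇒power; power⇒family)
    open Algebra.Properties.CommutativeSemiring.Exp commutativeSemiring
    open Algebra.Properties.Ring ring
    open import Relation.Binary.Reasoning.Setoid setoid
    private
      module code = Inverse code

    code-injective : ∀ {x y} → code.to x ≡ code.to y → x ≈ y
    code-injective eq = trans (sym (code.inverseʳ ≡.refl)) (code.inverseʳ eq)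

    ≡mod9⇒≈ : ∀ k l → k mod 9 ≡ l mod 9 → k · 1# ≈ l · 1#
    ≡mod9⇒≈ k l eq = code-injective (≡.trans (code-· k) (≡.trans eq (≡.sym (code-· l))))

    ≈⇒≡mod9 : ∀ k l → k · 1# ≈ l · 1# → k mod 9 ≡ l mod 9
    ≈⇒≡mod9 k l eq = ≡.trans (≡.sym (code-· k)) (≡.trans (code.to-cong eq) (code-· l))

    code≡⇒≈ : ∀ {x} k → code.to x ≡ k mod 9 → x ≈ k · 1#
    code≡⇒≈ k eq = code-injective (≡.trans eq (≡.sym (code-· k)))

    negative : ∀ k l → (k ℕ.+ l) mod 9 ≡ 0F → k · 1# ≈ - (l · 1#)
    negative k l eq = +-inverseˡ-unique _ _ (trans (sym (×-homo-+ 1# k l)) (≡mod9⇒≈ (k ℕ.+ l) 0 eq))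

    -- Only 1 and 8 have square 1 modulo 9, and ξ, being of order 2, is not 1.
    ξ≈-1 : ξ ≈ - (1 · 1#)
    ξ≈-1 = square-root-of-1 (code.to ξ) ≡.refl
      where
      square : ∀ k → code.to ξ ≡ k mod 9 → (k ℕ.* k) mod 9 ≡ 1 mod 9
      square k eq = ≈⇒≡mod9 (k ℕ.* k) 1 (begin
        (k ℕ.* k) · 1#         ≈⟨ ×1-homo-* k k ⟩
        (k · 1#) * (k · 1#)    ≈⟨ *-cong (code≡⇒≈ k eq) (trans (*-identityʳ ξ) (code≡⇒≈ k eq)) ⟨
        ξ ^ 2                  ≈⟨ ξ^n≈1 ⟩
        1#                     ≈⟨ +-identityʳ 1# ⟨
        1 · 1#                 ∎)
      square-root-of-1 : ∀ k → code.to ξ ≡ k → ξ ≈ - (1 · 1#)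
      square-root-of-1 0F eq = contradiction (square 0 eq) λ ()
      square-root-of-1 1F eq = contradiction (trans (*-identityʳ ξ) (trans (code≡⇒≈ 1 eq) (+-identityʳ 1#)))
                                 (minimal 1 (s≤s z≤n) (s≤s (s≤s z≤n)))
      square-root-of-1 2F eq = contradiction (square 2 eq) λ ()
      square-root-of-1 3F eq = contradiction (square 3 eq) λ ()
      square-root-of-1 4F eq = contradiction (square 4 eq) λ ()
      square-root-of-1 5F eq = contradiction (square 5 eq) λ ()
      square-root-of-1 6F eq = contradiction (square 6 eq) λ ()
      square-root-of-1 7F eq = contradiction (square 7 eq) λ ()
      square-root-of-1 8F eq = trans (code≡⇒≈ 8 eq) (negative 8 1 ≡.refl)

    ξ≈-1# : ξ ≈ - 1#
    ξ≈-1# = trans ξ≈-1 (-‿cong (+-identityʳ 1#))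

    ξ^≈±1 : ∀ k → ξ ^ k ≈ 1# ⊎ ξ ^ k ≈ - 1#
    ξ^≈±1 zero    = inj₁ refl
    ξ^≈±1 (suc k) with ξ^≈±1 k
    ... | inj₁ eq = inj₂ (trans (*-cong ξ≈-1# eq) (*-identityʳ _))
    ... | inj₂ eq = inj₁ (trans (*-cong ξ≈-1# eq) (trans (-1*x≈-x (- 1#)) (-‿involutive 1#)))

    -- The Teichmüller set is {0, 1, -1}, so 1 + 3α takes the values 1, 4 and -2 = 7; the 3 belongs
    -- to the set 3𝒯*.
    value : Maybe (Fin 3) → ℕ
    value (just 0F) = 1
    value (just 1F) = 4
    value (just 2F) = 7
    value nothing   = 3

    scale≈value : ∀ i → scale i ≈ value i · 1#
    scale≈value (just 0F) = +-congˡ (trans (+-identityˡ _) (trans (+-identityˡ _) (+-identityˡ _)))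
    scale≈value (just 1F) = refl
    scale≈value (just 2F) = begin
      1# + 3 · (ξ * 1#)         ≈⟨ +-congˡ (×-congʳ 3 (trans (*-identityʳ ξ) (trans ξ≈-1 (sym (negative 8 1 ≡.refl))))) ⟩
      1# + 3 · (8 · 1#)         ≈⟨ +-congˡ (×-assocˡ 1# 3 8) ⟩
      25 · 1#                   ≈⟨ ≡mod9⇒≈ 25 7 ≡.refl ⟩
      7 · 1#                    ∎
    scale≈value nothing   = refl

    -- Every nonzero residue modulo 9 is plus or minus exactly one of 1, 4, 7 and 3. The entry at 0
    -- is a dummy.
    index : Fin 9 → Maybe (Fin 3)
    index 0F = nothing
    index 1F = just 0F
    index 2F = just 2F
    index 3F = nothing
    index 4F = just 1F
    index 5F = just 1F
    index 6F = nothing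
    index 7F = just 2F
    index 8F = just 0F

    index-value : ∀ i → index (value i mod 9) ≡ i
    index-value (just 0F) = ≡.refl
    index-value (just 1F) = ≡.refl
    index-value (just 2F) = ≡.refl
    index-value nothing   = ≡.refl

    -- The factor 8 stands for -1 modulo 9.
    index-neg-value : ∀ i → index ((8 ℕ.* value i) mod 9) ≡ i
    index-neg-value (just 0F) = ≡.refl
    index-neg-value (just 1F) = ≡.refl
    index-neg-value (just 2F) = ≡.refl
    index-neg-value nothing   = ≡.refl

    -value : ∀ i → - (value i · 1#) ≈ (8 ℕ.* value i) · 1#
    -value i = sym (negative (8 ℕ.* value i) (value i) (9*value≡0 i))
      where
      9*value≡0 : ∀ i → (8 ℕ.* value i ℕ.+ value i) mod 9 ≡ 0F
      9*value≡0 (just 0F) = ≡.refl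
      9*value≡0 (just 1F) = ≡.refl
      9*value≡0 (just 2F) = ≡.refl
      9*value≡0 nothing   = ≡.refl

    value≢0 : ∀ i → ¬ value i mod 9 ≡ 0F
    value≢0 (just 0F) ()
    value≢0 (just 1F) ()
    value≢0 (just 2F) ()
    value≢0 nothing   ()

    ±value : ∀ k → ¬ k ≡ 0F → k ≡ value (index k) mod 9 ⊎ k ≡ (8 ℕ.* value (index k)) mod 9
    ±value 0F k≢0 = contradiction ≡.refl k≢0
    ±value 1F _   = inj₁ ≡.refl
    ±value 2F _   = inj₂ ≡.refl
    ±value 3F _   = inj₁ ≡.refl
    ±value 4F _   = inj₁ ≡.refl
    ±value 5F _   = inj₂ ≡.refl
    ±value 6F _   = inj₂ ≡.refl
    ±value 7F _   = inj₁ ≡.refl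
    ±value 8F _   = inj₂ ≡.refl

    family : Maybe (Fin 3) → Pred Carrier _
    family = teichmüllerFamily R 3 ξ 2

    family⇒± : ∀ {i x} → family i x → x ≈ scale i ⊎ x ≈ - scale i
    family⇒± {i} x∈ with k , x≈ ← family⇒power i x∈ = Sum.map
      (λ ξ^k≈1  → trans x≈ (trans (*-congˡ ξ^k≈1) (*-identityʳ _)))
      (λ ξ^k≈-1 → trans x≈ (trans (*-congˡ ξ^k≈-1) (trans (sym (-‿distribʳ-* _ 1#)) (-‿cong (*-identityʳ _)))))
      (ξ^≈±1 k)

    ±⇒family : ∀ {i x} → x ≈ scale i ⊎ x ≈ - scale i → family i x
    ±⇒family {i} (inj₁ x≈) = power⇒family i 0 (trans x≈ (sym (*-identityʳ _)))
    ±⇒family {i} (inj₂ x≈) = power⇒family i 1 (trans x≈ (sym (trans (*-congˡ (trans (*-identityʳ ξ) ξ≈-1#))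
      (trans (sym (-‿distribʳ-* _ 1#)) (-‿cong (*-identityʳ _))))))

    family⇒index : ∀ {i x} → family i x → index (code.to x) ≡ i
    family⇒index {i} x∈ with family⇒± x∈
    ... | inj₁ x≈ = ≡.trans (≡.cong index (≡.trans (code.to-cong (trans x≈ (scale≈value i))) (code-· (value i))))
                      (index-value i)
    ... | inj₂ x≈ = ≡.trans (≡.cong index (≡.trans (code.to-cong (trans x≈ (trans (-‿cong (scale≈value i)) (-value i))))
                      (code-· (8 ℕ.* value i)))) (index-neg-value i)

    family-cover : ∀ x → ¬ x ≈ 0# → ∃ λ i → family i x
    family-cover x x≉0 = index k , ±⇒family (Sum.map
      (λ eq → trans (code≡⇒≈ (value (index k)) eq) (sym (scale≈value (index k))))
      (λ eq → trans (code≡⇒≈ (8 ℕ.* value (index k)) eq) (sym (trans (-‿cong (scale≈value (index k))) (-value (index k)))))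
      (±value k λ k≡0 → x≉0 (code≡⇒≈ 0 k≡0)))
      where
      k = code.to x

    teichmüller-signPartition : SignPartition R family
    teichmüller-signPartition = record
      { half     = 5 · 1#
      ; 2*half≈1 = begin
          (1# + 1#) * (5 · 1#)     ≈⟨ *-congʳ (+-congˡ (+-identityʳ 1#)) ⟨
          (2 · 1#) * (5 · 1#)      ≈⟨ ×1-homo-* 2 5 ⟨
          10 · 1#                  ≈⟨ ≡mod9⇒≈ 10 1 ≡.refl ⟩
          1 · 1#                   ≈⟨ +-identityʳ 1# ⟩
          1#                       ∎
      ; rep      = scale
      ; rep≉0    = λ i eq → value≢0 i (≈⇒≡mod9 (value i) 0 (trans (sym (scale≈value i)) eq))
      ; D⇒±      = family⇒±
      ; ±⇒D      = ±⇒family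
      ; cover    = family-cover
      ; disjoint = λ x∈i x∈j → ≡.trans (≡.sym (family⇒index x∈i)) (family⇒index x∈j)
      }

-- Galois rings, and the case r = 1

module GaloisRing (p : ℕ) (f : List ℤ) where

  open Polynomial (ℤ/ (p ℕ.^ 2)) hiding (Poly; coeff; Monic; polynomialRing)
  open CommutativeRing (GR p f)
  open Algebra.Properties.Semiring.Mult semiring renaming (_×_ to _·_)

  factor⇒≈ : ∀ k {g h} → k *ₚ f ≈ₚ g +ₚ (-ₚ h) → g ≈ h
  factor⇒≈ k eq = Quotient.mk≈/ (RawMagma._,_ k eq)

  ≈⇒factor : ∀ {g h} → g ≈ h → ∃ λ k → k *ₚ f ≈ₚ g +ₚ (-ₚ h)
  ≈⇒factor (Quotient.mk≈/ (RawMagma._,_ k eq)) = k , eq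

  ≈ₚ⇒≈ : ∀ {g h} → g ≈ₚ h → g ≈ h
  ≈ₚ⇒≈ {g} {h} g≈h = factor⇒≈ [] (symₚ (transₚ (+-congₚ g≈h reflₚ) (+-inverseʳₚ h)))

  ·1≈constant : ∀ k → k · 1# ≈ (+ k ∷ [])
  ·1≈constant zero    = ≈ₚ⇒≈ (symₚ 0∷[]≈[])
  ·1≈constant (suc k) = +-congˡ {1#} (·1≈constant k)

  p²≈0 : (p · 1#) * (p · 1#) ≈ 0#
  p²≈0 = trans (sym (×1-homo-* p p)) (trans (·1≈constant (p ℕ.* p)) (≈ₚ⇒≈ (transₚ (∷-cong p*p≈0 reflₚ) 0∷[]≈[])))
    where
    p*p≈0 : CommutativeRing._≈_ (ℤ/ (p ℕ.^ 2)) (+ (p ℕ.* p)) (+ 0)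
    p*p≈0 = Quotient.mk≈/ (RawMagma._,_ (+ 1) (≡.trans (ℤ.*-identityˡ (+ (p ℕ.^ 2)))
      (≡.trans (≡.cong (λ k → + (p ℕ.* k)) (ℕ.*-identityʳ p)) (≡.sym (ℤ.+-identityʳ (+ (p ℕ.* p)))))))

  module LinearModulus .{{_ : ℕ.NonZero (p ℕ.^ 2)}} (f-monic : Monic (ℤ/ (p ℕ.^ 2)) 1 f) where

    open LinearQuotient (ℤ/ (p ℕ.^ 2)) f f-monic
    open Residues (p ℕ.^ 2)
    private
      module ℤ/p² = CommutativeRing (ℤ/ (p ℕ.^ 2))

    code : List ℤ → Fin (p ℕ.^ 2)
    code g = residue (eval g)

    eval-resp : ∀ {g h} → g ≈ h → eval g ℤ/p².≈ eval h
    eval-resp {g} {h} g≈h = let k , kf≈g-h = ≈⇒factor g≈h in factor⇒eval≈ k {g} {h} kf≈g-h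

    code-resp : ∀ {g h} → g ≈ h → code g ≡ code h
    code-resp {g} {h} g≈h = residue-cong {eval g} {eval h} (eval-resp {g} {h} g≈h)

    code-constant : ∀ a → code (constant a) ≡ residue a
    code-constant a = residue-cong (eval-constant a)

    -- A modulus of degree 1 has a root in ℤ/p², and evaluation there identifies the Galois ring
    -- with ℤ/p².
    residues : Inverse setoid (≡.setoid (Fin (p ℕ.^ 2)))
    residues = record
      { to        = code
      ; from      = λ k → constant (+ toℕ k)
      ; to-cong   = λ {g} {h} → code-resp {g} {h}
      ; from-cong = λ { ≡.refl → refl }
      ; inverse   = (λ {k} {g} g≈k → ≡.trans (code-resp {g} g≈k) (≡.trans (code-constant (+ toℕ k)) (residue-toℕ k)))
                  , (λ { {g} ≡.refl → trans {_} {constant (eval g)}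
                         (≈ₚ⇒≈ (∷-cong (residue≈ (eval g)) reflₚ)) (factor⇒≈ (quotient g) (remainder g)) })
      }

    code-·1 : ∀ k → code (k · 1#) ≡ k mod (p ℕ.^ 2)
    code-·1 k = ≡.trans (code-resp {k · 1#} {constant (+ k)} (·1≈constant k)) (code-constant (+ k))

-- The isomorphism for q = 3 and the nonisomorphism for q > 3

isomorphic : (F : CommutativeRing c ℓ) → IsFieldOfOrder F 9 → ∀ {α} → GeneratesUnits F α →
             ∀ {f} → Monic (ℤ/ (3 ℕ.^ 2)) 1 f → ∀ {ξ} → HasMultiplicativeOrder (GR 3 f) ξ 2 →
             dev-C F α 3 1 ≅ dev-E 3 1 f ξ
isomorphic F F-field α-generates {f} f-monic {ξ} ξ-order = pairDesigns-≅
  -- Any bijection of the points would do; this one matches the two enumerations by `Fin 9`.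
  (Composition.inverse (IsFieldOfOrder.order F-field) (Symmetry.inverse residues))
  (signPartition-pairDesign (FieldOfOrderNine.field-signPartition F F-field α-generates))
  (signPartition-pairDesign (CyclicRingOfOrderNine.teichmüller-signPartition (GR 3 f) residues code-·1 ξ ξ-order))
  where open GaloisRing.LinearModulus 3 f f-monic

-- The numbers q and Q are variables tied by equations: matching on these brings the order of the
-- field into the form `suc n * suc n` that `CyclotomicClasses` expects, while `p ^ r ≡ q` remains
-- an equation for use with Frobenius.
nonisomorphic : (F : CommutativeRing c ℓ) {p r m q Q : ℕ} → Prime p → p ℕ.^ r ≡ q → q ≡ 4 ℕ.+ m →
                Q ≡ q ℕ.* q → Q ≡ p ℕ.^ (2 ℕ.* r) → IsFieldOfOrder F Q → ∀ {α} → GeneratesUnits F α →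
                (R : CommutativeRing c′ ℓ′) (let open CommutativeRing R) →
                (let open Algebra.Properties.Semiring.Mult semiring using () renaming (_×_ to _·_)) →
                (p · 1#) * (p · 1#) ≈ 0# → ∀ {ξ} → HasMultiplicativeOrder R ξ (q ℕ.∸ 1) →
                ¬ dev (CommutativeRing.+-abelianGroup F) (cyclotomicClass F α (suc q))
                    ≅ dev +-abelianGroup (teichmüllerFamily R p ξ (q ℕ.∸ 1))
nonisomorphic F {p} {r} {m} p-prime p^r≡q ≡.refl ≡.refl Q≡p^2r F-field α-generates R p²≈0 {ξ} ξ-order iso =
  teichmüller-not-puncturedLines R p ξ ξ-order
    (Transport.puncturedLines dev≅powerDesign (Transport.puncturedLines iso
      (spread-puncturedLines (cyclotomic-spread additive))))
    p²≈0
  where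
  open CyclotomicClasses F {3 ℕ.+ m} F-field α-generates
  open TeichmüllerFamily R p ξ ξ-order (s≤s (s≤s z≤n))
  module F = CommutativeRing F
  open Algebra.Properties.CommutativeSemiring.Exp F.commutativeSemiring using (_^_)
  additive : ∀ x y → (x F.+ y) ^ (4 ℕ.+ m) F.≈ x ^ (4 ℕ.+ m) F.+ y ^ (4 ℕ.+ m)
  additive x y = ≡.subst (λ q → (x F.+ y) ^ q F.≈ x ^ q F.+ y ^ q) p^r≡q
    (Frobenius.frobenius^ F p-prime (FiniteField.characteristic F F-field p (2 ℕ.* r) Q≡p^2r) r x y)

-- As p divides the prime 3, it is 3; an exponent of 2 or more would make the power at least 9.
p^r≡3⇒p≡3∧r≡1 : ∀ {p} r → Prime p → p ℕ.^ r ≡ 3 → p ≡ 3 × r ≡ 1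
p^r≡3⇒p≡3∧r≡1 {p} (suc r) p-prime p^r≡3
  with prime⇒irreducible (toWitness {a? = prime? 3} _) (divides (p ℕ.^ r) (≡.trans (≡.sym p^r≡3) (ℕ.*-comm p (p ℕ.^ r))))
... | inj₁ ≡.refl = contradiction ≡.refl (ℕ.nonTrivial⇒≢1 {{prime⇒nonTrivial p-prime}})
p^r≡3⇒p≡3∧r≡1 (suc zero)    p-prime p^r≡3 | inj₂ ≡.refl = ≡.refl , ≡.refl
p^r≡3⇒p≡3∧r≡1 (suc (suc r)) p-prime p^r≡3 | inj₂ ≡.refl = contradiction p^r≡3
  (ℕ.>⇒≢ (ℕ.<-≤-trans (s≤s (s≤s (s≤s (s≤s z≤n)))) (ℕ.*-monoʳ-≤ 3 (ℕ.*-monoʳ-≤ 3 (ℕ.m^n>0 3 r)))))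

open import Data.Nat.Base using (_≤_; _*_; _^_; _∸_)

theorem5p4 : ∀ {c ℓ} (p r : ℕ) → Prime p → 1 ≤ r → 3 ≤ p ^ r →
    (F : CommutativeRing c ℓ) → IsFieldOfOrder F (p ^ (2 * r)) →
    (α : CommutativeRing.Carrier F) → GeneratesUnits F α →
    (f : List ℤ) → IsBasicIrreducible p r f →
    (ξ : CommutativeRing.Carrier (GR p f)) → HasMultiplicativeOrder (GR p f) ξ (p ^ r ∸ 1) →
    ((p ≡ 3 × r ≡ 1) → dev-C F α p r ≅ dev-E p r f ξ)
    × (¬ (p ≡ 3 × r ≡ 1) → ¬ (dev-C F α p r ≅ dev-E p r f ξ))
theorem5p4 p r p-prime _ 3≤p^r F F-field α α-generates f f-basic ξ ξ-order =
  (λ { (≡.refl , ≡.refl) → isomorphic F F-field α-generates (IsBasicIrreducible.monic f-basic) ξ-order }) ,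
  (λ ¬3,1 → nonisomorphic F {p} {r} p-prime ≡.refl
    -- Excluding q = 3 turns 3 ≤ q into 4 ≤ q, so that q = 4 + m with m = q - 4.
    (≡.sym (ℕ.m+[n∸m]≡n (ℕ.≤∧≢⇒< 3≤p^r λ 3≡p^r → ¬3,1 (p^r≡3⇒p≡3∧r≡1 r p-prime (≡.sym 3≡p^r)))))
    p^2r≡p^r*p^r ≡.refl F-field α-generates (GR p f) (GaloisRing.p²≈0 p f) ξ-order)
  where
  p^2r≡p^r*p^r : p ^ (2 * r) ≡ p ^ r * p ^ r
  p^2r≡p^r*p^r = ≡.trans (≡.cong (λ s → p ^ (r ℕ.+ s)) (ℕ.+-identityʳ r)) (ℕ.^-distribˡ-+-* p r r)
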